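{- Let $F$ be a digraph, and for every arc $e$ of $F$ let $(a_e,b_e,r_e,q_e)$ be a tuple of integers with $q_e\ge 2$ and $\gcd(a_e,q_e)=\gcd(b_e,q_e)=1$. Then there is an integer $N$ such that the following holds. For every digraph $D$ and all sets $Z_1,Z_2\subseteq A(D)$ with $\mu(D,Z_1,Z_2)\ge N$, the digraph $D$ contains a subdigraph isomorphic to a subdivision of $F$ in which, for every arc $e$ of $F$, the branching path $P_e$ corresponding to $e$ satisfies $$a_e\,|A(P_e)\cap Z_1|+b_e\,|A(P_e)\cap Z_2|\equiv r_e \pmod{q_e}.$$
   Context: All digraphs are finite; an arc is an ordered pair $(u,v)$ of distinct vertices (both $(u,v)$ and $(v,u)$ may be present, and then they form a directed cycle of length 2). $V(D)$ and $A(D)$ denote the vertex set and arc set of a digraph $D$, and for $X\subseteq V(D)$, $D[X]$ is the subdigraph induced by $X$. For $Z_1,Z_2\subseteq A(D)$ (not necessarily disjoint), a directed cycle $C$ of $D$ is called $(Z_1,Z_2)$-unbalanced if $|A(C)\cap Z_1|\ne |A(C)\cap Z_2|$. The $(Z_1,Z_2)$-unbalanced dichromatic number $\mu(D,Z_1,Z_2)$ is the minimum number of parts in a partition $\mathcal{P}$ of $V(D)$ such that for every $P\in\mathcal{P}$ the subdigraph $D[P]$ contains no $(Z_1,Z_2)$-unbalanced directed cycle. A digraph $H$ is a subdivision of a digraph $F$ if $H$ is obtained from $F$ by replacing a set $\{e_1,\dots,e_k\}$ of arcs of $F$ by pairwise internally vertex-disjoint directed paths $P_1,\dots,P_k$ (whose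 internal vertices are new) such that if $e_i=(u,v)$ then $P_i$ is a directed path from $u$ to $v$. The branching path $P_e$ corresponding to an arc $e$ of $F$ is the directed path replacing $e$ (or the arc $e$ itself, viewed as a path of length 1, if it is not replaced). -}

module Defs where

open import Data.Bool using (Bool; true; T)
open import Data.Bool.Properties using (T?)
open import Data.Empty using (⊥-elim)
open import Data.Fin using (Fin; zero; suc; finToFun; funToFin)
import Data.Fin.Properties as Fin
open import Data.Integer as ℤ using (ℤ)
open import Data.Integer.Divisibility.Signed using (_∣_)
open import Data.List using (List; []; _∷_; _∷ʳ_; drop; filterᵇ; length; lookup; map)
open import Data.List.Membership.Propositional using (_∈_; _∉_)
open import Data.List.Membership.Propositional.Properties using (∈-lookup)
open import Data.List.Relation.Binary.Disjoint.Propositional using (Disjoint)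
open import Data.List.Relation.Unary.All as All using (All; []; _∷_)
open import Data.List.Relation.Unary.AllPairs using ([]; _∷_)
open import Data.List.Relation.Unary.Unique.Propositional using (Unique)
open import Data.Nat using (ℕ; zero; suc; _≤_; _<_; _<?_; _≟_; _^_; z≤n; s≤s)
import Data.Nat.Properties as ℕ
open import Data.Product using (Σ-syntax; ∃; ∃-syntax; _×_; _,_; proj₁; proj₂)
open import Data.Sum using (_⊎_)
open import Function using (_∘_; id)
open import Function.Definitions using (Injective; StrictlySurjective)
open import Relation.Binary.Construct.Closure.ReflexiveTransitive using (Star; ε; _◅_)
open import Relation.Binary.PropositionalEquality
open import Relation.Nullary using (¬_; Dec; yes; no)
open import Relation.Nullary.Decidable using (map′; ¬?; _×-dec_)
open import Relation.Unary using (Decidable)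

record Digraph : Set where
  field
    order    : ℕ
    adjacent : Fin order → Fin order → Bool
    loopless : ∀ v → ¬ T (adjacent v v)

V : Digraph → Set
V D = Fin (Digraph.order D)

record _∋_⟶_ (D : Digraph) (u v : V D) : Set where
  constructor arc
  field isArc : T (Digraph.adjacent D u v)

-- T b has at most one element, so A D is the arc set, not a multiset.
A : Digraph → Set
A D = ∃[ u ] ∃[ v ] D ∋ u ⟶ v

ArcSet : Digraph → Set
ArcSet D = A D → Bool

Walk : (D : Digraph) → V D → V D → Set
Walk D = Star (D ∋_⟶_)

module _ {D : Digraph} where

  arcs : ∀ {u v} → Walk D u v → List (A D)
  arcs ε       = []
  arcs (e ◅ w) = (_ , _ , e) ∷ arcs w

  -- All vertices except the final one.
  tails : ∀ {u v} → Walk D u v → List (V D)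
  tails w = map proj₁ (arcs w)

  vertices : ∀ {u v} → Walk D u v → List (V D)
  vertices {v = v} w = tails w ∷ʳ v

  interior : ∀ {u v} → Walk D u v → List (V D)
  interior w = drop 1 (tails w)

  IsPath : ∀ {u v} → Walk D u v → Set
  IsPath w = Unique (vertices w)

  -- Paths and directed cycles repeat no arc, so for them this is the
  -- cardinality of A(w) ∩ Z.
  ∣_∩_∣ : ∀ {u v} → Walk D u v → ArcSet D → ℕ
  ∣ w ∩ Z ∣ = length (filterᵇ Z (arcs w))

-- A directed cycle with a choice of starting vertex.
record Cycle (D : Digraph) : Set where
  field
    {base}   : V D
    walk     : Walk D base base
    nonempty : 0 < length (arcs walk)
    simple   : Unique (tails walk)

module _ {D : Digraph} where

  Unbalanced : (Z₁ Z₂ : ArcSet D) → Cycle D → Set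
  Unbalanced Z₁ Z₂ C = ∣ Cycle.walk C ∩ Z₁ ∣ ≢ ∣ Cycle.walk C ∩ Z₂ ∣

  -- C is a directed cycle of D[X]. As D[X] has all arcs of D between members
  -- of X, this only says that the vertices of C are in X.
  _InInduced_ : Cycle D → (V D → Set) → Set
  C InInduced X = All X (tails (Cycle.walk C))

module _ (D : Digraph) (Z₁ Z₂ : ArcSet D) where

  -- A partition into k nonempty parts is a surjection onto Fin k, its parts
  -- being the fibres.
  IsGoodPartition : (k : ℕ) → (V D → Fin k) → Set
  IsGoodPartition k part =
      StrictlySurjective _≡_ part
    × (∀ i → ¬ (∃[ C ] (C InInduced (λ v → part v ≡ i)) × Unbalanced Z₁ Z₂ C))

  HasGoodPartition : ℕ → Set
  HasGoodPartition k = ∃ (IsGoodPartition k)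

IsLeast : (ℕ → Set) → ℕ → Set
IsLeast P m = P m × (∀ k → P k → m ≤ k)

-- To obtain μ as a natural number, HasGoodPartition is shown to be decidable
-- and to hold for the partition into singletons.

least : ∀ {P : ℕ → Set} → Decidable P → ∀ n → P n → ∃ (IsLeast P)
least P? zero    pn = zero , pn , λ _ _ → z≤n
least P? (suc n) pn with P? 0
... | yes p0 = zero , p0 , λ _ _ → z≤n
... | no ¬p0 with least (P? ∘ suc) n pn
...   | m , pm , min = suc m , pm , λ where
          zero    p → ⊥-elim (¬p0 p)
          (suc k) p → s≤s (min k p)

lookup-injective : ∀ {X : Set} {xs : List X} → Unique xs → Injective _≡_ _≡_ (lookup xs)
lookup-injective {xs = _ ∷ _} _       {zero}  {zero}  _  = refl
lookup-injective {xs = _ ∷ _} (x ∷ _) {zero}  {suc j} eq = ⊥-elim (All.lookup x (∈-lookup j) eq)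
lookup-injective {xs = _ ∷ _} (x ∷ _) {suc i} {zero}  eq = ⊥-elim (All.lookup x (∈-lookup i) (sym eq))
lookup-injective {xs = _ ∷ _} (_ ∷ u) {suc i} {suc j} eq = cong suc (lookup-injective u eq)

module _ {D : Digraph} where
  open Digraph D using (adjacent; order; loopless)
  open import Data.List.Relation.Unary.Unique.DecPropositional (Fin._≟_ {order}) using (unique?)

  arc-irrelevant : ∀ {u v} (e f : D ∋ u ⟶ v) → e ≡ f
  arc-irrelevant {u} {v} (arc p) (arc q) = cong arc (go p q)
    where
    go : ∀ {b} (p q : T b) → p ≡ q
    go {true} _ _ = refl

  anyWalk? : ∀ k {u v} {Q : Walk D u v → Set} → Decidable Q →
             Dec (∃[ w ] length (tails w) ≡ k × Q w)
  anyWalk? zero {u} {v} Q? with u Fin.≟ v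
  ... | no u≢v   = no λ { (ε , _) → u≢v refl }
  ... | yes refl = map′ (λ q → ε , refl , q) (λ { (ε , _ , q) → q }) (Q? ε)
  anyWalk? (suc k) {u} {v} {Q} Q? =
    map′ (λ { (_ , e , w , eq , q) → e ◅ w , cong suc eq , q })
         (λ { (e ◅ w , eq , q) → _ , e , w , ℕ.suc-injective eq , q })
         (Fin.any? step?)
    where
    Step : V D → Set
    Step x = Σ[ e ∈ D ∋ u ⟶ x ] ∃[ w ] length (tails w) ≡ k × Q (e ◅ w)

    step? : Decidable Step
    step? x with T? (adjacent u x)
    ... | no ¬e = no λ { (arc e , _) → ¬e e }
    ... | yes e = map′ (arc e ,_)
                       (λ { (e′ , w , eq , q) →
                            w , eq , subst (λ z → Q (z ◅ w)) (arc-irrelevant e′ (arc e)) q })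
                       (anyWalk? k (λ w → Q? (arc e ◅ w)))

  anyCycle? : {Q : ∀ {b} → Walk D b b → Set} → (∀ {b} (w : Walk D b b) → Dec (Q w)) →
              Dec (∃[ C ] Q (Cycle.walk C))
  anyCycle? {Q} Q? =
    map′ (λ { (_ , _ , _ , w , _ , ne , s , q) →
              record { walk = w ; nonempty = ne ; simple = s } , q })
         (λ { (C , q) → let open Cycle C in
              _ , s≤s (Fin.injective⇒≤ (lookup-injective simple)) ,
              base , walk , refl , nonempty , simple , q })
         (ℕ.anyUpTo? (λ k → Fin.any? λ b → anyWalk? k {b} λ w →
                        0 <? length (arcs w) ×-dec unique? (tails w) ×-dec Q? w)
                     (suc order))

module _ (D : Digraph) (Z₁ Z₂ : ArcSet D) where
  open Digraph D using (order; loopless)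

  isGoodPartition? : ∀ k part → Dec (IsGoodPartition D Z₁ Z₂ k part)
  isGoodPartition? k part =
    Fin.all? (λ i → Fin.any? λ v → part v Fin.≟ i) ×-dec
    Fin.all? (λ i → ¬? (anyCycle? λ w →
      All.all? (λ v → part v Fin.≟ i) (tails w) ×-dec ¬? (∣ w ∩ Z₁ ∣ ≟ ∣ w ∩ Z₂ ∣)))

  isGoodPartition-resp : ∀ {k} {f g : V D → Fin k} → f ≗ g →
                         IsGoodPartition D Z₁ Z₂ k f → IsGoodPartition D Z₁ Z₂ k g
  isGoodPartition-resp f≗g (surj , good) =
    (λ i → let v , eq = surj i in v , trans (sym (f≗g v)) eq) ,
    (λ { i (C , inside , unb) → good i (C , All.map (trans (f≗g _)) inside , unb) })

  hasGoodPartition? : Decidable (HasGoodPartition D Z₁ Z₂)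
  hasGoodPartition? k =
    map′ (λ { (c , good) → finToFun c , good })
         (λ { (f , good) → funToFin f ,
              isGoodPartition-resp (λ v → sym (Fin.finToFun-funToFin f v)) good })
         (Fin.any? {n = k ^ order} λ c → isGoodPartition? k (finToFun c))

  singletons : HasGoodPartition D Z₁ Z₂ order
  singletons = id , (λ i → i , refl) , λ { i (C , inside , _) → absurd C inside }
    where
    no-cycle : ∀ {b i} (w : Walk D b b) → 0 < length (arcs w) → ¬ All (_≡ i) (tails w)
    no-cycle (arc e ◅ ε)     _ _                 = loopless _ e
    no-cycle (arc e ◅ f ◅ w) _ (refl ∷ refl ∷ _) = loopless _ e
    absurd : ∀ {i} (C : Cycle D) → ¬ (C InInduced (_≡ i))
    absurd C = no-cycle (Cycle.walk C) (Cycle.nonempty C)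

  μ-exists : ∃ (IsLeast (HasGoodPartition D Z₁ Z₂))
  μ-exists = least hasGoodPartition? order singletons

  -- The (Z₁,Z₂)-unbalanced dichromatic number.
  μ : ℕ
  μ = proj₁ μ-exists

  μ-isLeast : IsLeast (HasGoodPartition D Z₁ Z₂) μ
  μ-isLeast = proj₂ μ-exists

-- H is a subdivision of F, up to isomorphism: branch embeds V(F) in V(H), and
-- the arcs of F become the branching paths, of which H consists. An arc that
-- is not replaced has a branching path of length 1.
record Subdivision (F H : Digraph) : Set where
  field
    branch           : V F → V H
    branch-injective : Injective _≡_ _≡_ branch
    path             : ((u , v , _) : A F) → Walk H (branch u) (branch v)
    isPath           : ∀ e → IsPath (path e)
    interior-new     : ∀ e v → branch v ∉ interior (path e)
    interior-disjoint : ∀ {e e′} → e ≢ e′ → Disjoint (interior (path e)) (interior (path e′))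
    covers-vertices  : ∀ x → (∃[ v ] branch v ≡ x) ⊎ (∃[ e ] x ∈ interior (path e))
    covers-arcs      : ∀ a → ∃[ e ] a ∈ arcs (path e)

-- An isomorphism from H onto a (not necessarily induced) subdigraph of D.
record _↪_ (H D : Digraph) : Set where
  field
    vertex    : V H → V D
    injective : Injective _≡_ _≡_ vertex
    preserves : ∀ {u v} → H ∋ u ⟶ v → D ∋ vertex u ⟶ vertex v

  onArc : A H → A D
  onArc (u , v , e) = vertex u , vertex v , preserves e

  -- The arcs of H whose copies in D belong to Z.
  pullback : ArcSet D → ArcSet H
  pullback Z = Z ∘ onArc

open Subdivision public using (path)
open _↪_ public using (pullback)

_≡_[mod_] : ℤ → ℤ → ℤ → Set
x ≡ y [mod q ] = q ∣ x ℤ.- y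

{-# OPTIONS --safe #-}

-- Let μ be large. In a strongly connected subdigraph, some set Y lies both in
-- one distance level from a root and in one distance level to it and still has
-- large μ; any two of its vertices are then joined by a path, via the root,
-- with interior outside Y. Nesting such sets gives layers of disjoint detours,
-- so an induction on the arcs of F produces a subdivision as soon as the
-- residue of these paths can be prescribed.
--
-- To gain freedom in the residue, choose a vertex x and a set C of large μ
-- whose vertices reach x, through an inner layer, by paths of equal residue.
-- C has a strongly connected subset S with bounded μ that is not 2-colourable.
-- From any s₀ in S some path in S reaches the tail of an arc of S that is in
-- exactly one of Z₁ and Z₂, without meeting its head: otherwise every such arc
-- leads down in distance from s₀, and the parity of the distance 2-colours S.
-- Using or skipping this arc, then going to x, changes the weight by a or by b.
-- After 2q such detours, q of them change it by the same one of a and b, a unit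
-- modulo q, so every residue is attained.

module Submission where

open import Defs
open import Data.Bool using (true; false)
open import Data.Bool.Properties using (T?)
open import Data.Fin as Fin using (Fin; zero; suc; toℕ; fromℕ<; finToFun; funToFin; combine; opposite; inject≤; punchOut)
import Data.Fin.Properties as Fin
open import Data.Integer using (ℤ; +_; 0ℤ; 1ℤ)
import Data.Integer as ℤ
import Data.Integer.DivMod as ℤ
open import Data.Integer.Divisibility.Signed using (_∣_; divides; ∣m∣n⇒∣m+n; ∣m⇒∣-m; ∣n⇒∣m*n)
open import Data.Integer.GCD using (gcd)
import Data.Integer.Properties as ℤ
open import Data.Integer.Tactic.RingSolver using (solve-∀)
open import Data.List using (List; []; _∷_; _∷ʳ_; _++_; allFin; concatMap; drop; filter; filterᵇ; length; lookup; map)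
import Data.List.Properties as List
open import Data.List.Membership.Propositional using (_∈_; _∉_)
import Data.List.Membership.Propositional.Properties as ∈
open import Data.List.Relation.Binary.Disjoint.Propositional using (Disjoint)
open import Data.List.Relation.Unary.All as All using (All; []; _∷_)
import Data.List.Relation.Unary.All.Properties as All
open import Data.List.Relation.Unary.AllPairs using ([]; _∷_)
open import Data.List.Relation.Unary.Any as Any using (Any; here; there)
import Data.List.Relation.Unary.Any.Properties as Any
open import Data.List.Relation.Unary.Unique.Propositional using (Unique)
import Data.List.Relation.Unary.Unique.Propositional.Properties as Unique
open import Data.Nat as ℕ using (ℕ; zero; suc; _≟_; z≤n; s≤s)
import Data.Nat.Coprimality as Coprimality
import Data.Nat.GCD as ℕ
import Data.Nat.Properties as ℕ
open import Data.Product using (Σ-syntax; ∃; ∃-syntax; ∃₂; _×_; _,_; proj₁; proj₂)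
open import Data.Sum using (_⊎_; inj₁; inj₂; [_,_]′)
open import Data.Unit using (tt)
open import Function using (_∘_; case_of_)
open import Function.Definitions using (Injective)
open import Level using (0ℓ)
open import Relation.Binary using (Rel; IsPartialOrder)
import Relation.Binary.Construct.Flip.EqAndOrd as Flip
open import Relation.Binary.Construct.Closure.ReflexiveTransitive using (ε; _◅_; _◅◅_)
open import Relation.Binary.PropositionalEquality
open import Relation.Nullary using (¬_; Dec; yes; no; contradiction)
open import Relation.Nullary.Decidable using (⌊_⌋; map′; ¬?; _×-dec_; _⊎-dec_; toWitness; fromWitness; decidable-stable)
open import Relation.Unary using (Pred; Decidable)

-- Walks, paths and cycles.

module _ {D : Digraph} where
  open import Data.Nat using (_≤_; _<_)

  private
    variable
      u v x y : V D

  start∈ : (w : Walk D u v) → u ∈ vertices w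
  start∈ ε       = here refl
  start∈ (e ◅ w) = here refl

  end∈ : (w : Walk D u v) → v ∈ vertices w
  end∈ ε       = here refl
  end∈ (e ◅ w) = there (end∈ w)

  arcs-◅◅ : (w : Walk D u v) (w′ : Walk D v x) → arcs (w ◅◅ w′) ≡ arcs w ++ arcs w′
  arcs-◅◅ ε       w′ = refl
  arcs-◅◅ (e ◅ w) w′ = cong (_ ∷_) (arcs-◅◅ w w′)

  ∈-◅◅⁻ : (w : Walk D u v) {w′ : Walk D v x} →
          y ∈ vertices (w ◅◅ w′) → y ∈ vertices w ⊎ y ∈ vertices w′
  ∈-◅◅⁻ ε       i         = inj₂ i
  ∈-◅◅⁻ (e ◅ w) (here eq) = inj₁ (here eq)
  ∈-◅◅⁻ (e ◅ w) (there i) = [ inj₁ ∘ there , inj₂ ]′ (∈-◅◅⁻ w i)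

  ◅◅-isPath : (w : Walk D u v) {w′ : Walk D v x} → IsPath w → IsPath w′ →
              (∀ {y} → y ∈ vertices w → y ∈ vertices w′ → y ≡ v) → IsPath (w ◅◅ w′)
  ◅◅-isPath ε       _          path′ _     = path′
  ◅◅-isPath (e ◅ w) (u∉ ∷ uw) path′ joint =
    All.tabulate (λ i → λ { refl → case ∈-◅◅⁻ w i of λ where
      (inj₁ i) → All.lookup u∉ i refl
      (inj₂ i) → All.lookup u∉ (end∈ w) (joint (here refl) i) })
    ∷ ◅◅-isPath w uw path′ (joint ∘ there)

  -- The last alternative serves distance arguments: on a shortest walk, a vertex other than the
  -- first is strictly closer to the end. The non-strict length bound carries the recursion.
  suffix : (w : Walk D u v) → y ∈ vertices w →
           Σ[ w′ ∈ Walk D y v ] (∀ {z} → z ∈ vertices w′ → z ∈ vertices w)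
             × (IsPath w → IsPath w′)
             × length (tails w′) ≤ length (tails w)
             × (y ≡ u ⊎ length (tails w′) < length (tails w))
  suffix ε       (here refl) = ε , (λ i → i) , (λ p → p) , z≤n , inj₁ refl
  suffix (e ◅ w) (here refl) = e ◅ w , (λ i → i) , (λ p → p) , ℕ.≤-refl , inj₁ refl
  suffix (e ◅ w) (there i)   =
    let w′ , incl , isP , le , _ = suffix w i in
    w′ , there ∘ incl , (λ { (_ ∷ p) → isP p }) , ℕ.m≤n⇒m≤1+n le , inj₂ (s≤s le)

  prefix : (w : Walk D u v) → y ∈ vertices w →
           Σ[ w′ ∈ Walk D u y ] (∀ {z} → z ∈ vertices w′ → z ∈ vertices w)
             × (y ≡ v ⊎ length (tails w′) < length (tails w))
  prefix ε       (here refl) = ε , (λ i → i) , inj₁ refl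
  prefix (e ◅ w) (here refl) = ε , (λ { (here eq) → here eq }) , inj₂ (s≤s z≤n)
  prefix (e ◅ w) (there i)   =
    let w′ , incl , short = prefix w i in
    e ◅ w′ , (λ { (here eq) → here eq ; (there i) → there (incl i) }) ,
    [ inj₁ , inj₂ ∘ s≤s ]′ short

  open import Data.List.Membership.DecPropositional (Fin._≟_ {Digraph.order D}) using (_∈?_)

  -- Loop erasure from the end: if the first vertex recurs on the path already obtained for the
  -- rest, the suffix from that occurrence replaces the whole walk.
  erase : (w : Walk D u v) →
          Σ[ w′ ∈ Walk D u v ] IsPath w′ × (∀ {y} → y ∈ vertices w′ → y ∈ vertices w)
  erase ε = ε , [] ∷ [] , λ i → i
  erase {u} (e ◅ w) with erase w
  ... | w′ , path′ , incl with u ∈? vertices w′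
  ...   | yes i = let s , incl′ , isP , _ = suffix w′ i in
                  s , isP path′ , there ∘ incl ∘ incl′
  ...   | no u∉ = e ◅ w′ , All.tabulate (λ { i refl → u∉ i }) ∷ path′ ,
                  λ { (here eq) → here eq ; (there i) → there (incl i) }

  path-length : (w : Walk D u v) → IsPath w → length (tails w) < Digraph.order D
  path-length w path′ =
    subst (_≤ _) (List.length-++-comm (tails w) (_ ∷ []))
      (Fin.injective⇒≤ (lookup-injective path′))

  All-start : {Q : V D → Set} (w : Walk D u v) → All Q (tails w) → Q v → Q u
  All-start ε       _       qv = qv
  All-start (e ◅ w) (q ∷ _) _  = q

  -- The order is a parameter because distances to a root are used with ≤ and distances from a root
  -- with ≥.
  monotone-on-walk :
    {_≼_ : Rel ℕ 0ℓ} → IsPartialOrder _≡_ _≼_ →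
    (ℓ : V D → ℕ) {Q : V D → Set} →
    (∀ {x y} → D ∋ x ⟶ y → Q x → Q y → ℓ x ≼ ℓ y) →
    (w : Walk D u v) → All Q (tails w) → Q v →
    ℓ u ≼ ℓ v × All (λ y → ℓ u ≼ ℓ y × ℓ y ≼ ℓ v) (tails w)
  monotone-on-walk {v = v} {_≼_} po ℓ {Q} step = go
    where
    open IsPartialOrder po renaming (refl to ≼-refl; trans to ≼-trans)
    go : ∀ {u} (w : Walk D u v) → All Q (tails w) → Q v →
         ℓ u ≼ ℓ v × All (λ y → ℓ u ≼ ℓ y × ℓ y ≼ ℓ v) (tails w)
    go ε       _        _  = ≼-refl , []
    go (e ◅ w) (qu ∷ q) qv =
      let x≼v , all = go w q qv
          u≼x       = step e qu (All-start w q qv)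
          u≼v       = ≼-trans u≼x x≼v in
      u≼v , (≼-refl , u≼v) ∷ All.map (λ (x≼y , y≼v) → ≼-trans u≼x x≼y , y≼v) all

  All-base : (C : Cycle D) {Q : V D → Set} → C InInduced Q → Q (Cycle.base C)
  All-base record { walk = e ◅ w } (q ∷ _) = q

  -- A cycle returns to its base, so each value on it lies both above and below the base value, and
  -- antisymmetry applies.
  cycle-constant :
    {_≼_ : Rel ℕ 0ℓ} → IsPartialOrder _≡_ _≼_ →
    (ℓ : V D → ℕ) {Q : V D → Set} →
    (∀ {x y} → D ∋ x ⟶ y → Q x → Q y → ℓ x ≼ ℓ y) →
    (C : Cycle D) → C InInduced Q → C InInduced (λ v → ℓ v ≡ ℓ (Cycle.base C))
  cycle-constant po ℓ step C inQ =
    All.map (λ (b≼y , y≼b) → IsPartialOrder.antisym po y≼b b≼y)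
      (proj₂ (monotone-on-walk po ℓ step (Cycle.walk C) inQ (All-base C inQ)))

  -- If every arc lay in both or in neither of the two sets, the counts would agree.
  arc-where-different :
    (Z₁ Z₂ : ArcSet D) {Q : V D → Set} (w : Walk D u v) → All Q (tails w) → Q v →
    ∣ w ∩ Z₁ ∣ ≢ ∣ w ∩ Z₂ ∣ →
    ∃₂ λ x y → Σ[ e ∈ D ∋ x ⟶ y ] Q x × Q y × Z₁ (x , y , e) ≢ Z₂ (x , y , e)
  arc-where-different Z₁ Z₂ ε _ _ different = contradiction refl different
  arc-where-different Z₁ Z₂ {Q} (e ◅ w) (q ∷ qs) qv different
    with Z₁ (_ , _ , e) in eq₁ | Z₂ (_ , _ , e) in eq₂
  ... | true  | true  = arc-where-different Z₁ Z₂ w qs qv (different ∘ cong suc)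
  ... | false | false = arc-where-different Z₁ Z₂ w qs qv different
  ... | true  | false = _ , _ , e , q , All-start w qs qv , λ eq → case trans (sym eq₁) (trans eq eq₂) of λ ()
  ... | false | true  = _ , _ , e , q , All-start w qs qv , λ eq → case trans (sym eq₁) (trans eq eq₂) of λ ()

-- Decidable vertex sets.

record VertexSet (D : Digraph) : Set₁ where
  constructor ⟨_⟩
  field
    {mem} : V D → Set
    mem?  : Decidable mem

open VertexSet

module _ {D : Digraph} where

  infix  4 _∈ˢ_ _⊆ˢ_
  infixl 5 _∩_ _∖_

  _∈ˢ_ : V D → VertexSet D → Set
  v ∈ˢ X = mem X v

  _⊆ˢ_ : VertexSet D → VertexSet D → Set
  Y ⊆ˢ X = ∀ {v} → v ∈ˢ Y → v ∈ˢ X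

  _∩_ : (X : VertexSet D) {P : Pred (V D) 0ℓ} → Decidable P → VertexSet D
  X ∩ P? = ⟨ (λ v → mem? X v ×-dec P? v) ⟩

  _∖_ : VertexSet D → VertexSet D → VertexSet D
  X ∖ Y = X ∩ (λ v → ¬? (mem? Y v))

  ⁅_⁆ : V D → VertexSet D
  ⁅ x ⁆ = ⟨ Fin._≟ x ⟩

  full : VertexSet D
  full = ⟨ (λ _ → yes tt) ⟩

-- Colourings without monochromatic unbalanced cycles.

module Colourings (D : Digraph) (Z₁ Z₂ : ArcSet D) where
  open Digraph D using (order; loopless)
  open import Data.Nat using (_*_; _≤_; _<_; _^_)

  private
    variable
      k m n : ℕ
      X Y : VertexSet D

  -- Unlike in a good partition, parts may be empty.
  IsColouring : VertexSet D → (V D → Fin k) → Set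
  IsColouring X f =
    ∀ i → ¬ (∃[ C ] (C InInduced (λ v → v ∈ˢ X × f v ≡ i)) × Unbalanced Z₁ Z₂ C)

  record Colourable (k : ℕ) (X : VertexSet D) : Set where
    constructor _,_
    field
      assignment  : V D → Fin k
      isColouring : IsColouring X assignment

  isColouring? : ∀ X (f : V D → Fin k) → Dec (IsColouring X f)
  isColouring? X f =
    Fin.all? (λ i → ¬? (anyCycle? λ w →
      All.all? (λ v → mem? X v ×-dec f v Fin.≟ i) (tails w) ×-dec ¬? (∣ w ∩ Z₁ ∣ ≟ ∣ w ∩ Z₂ ∣)))

  colourable? : ∀ k X → Dec (Colourable k X)
  colourable? k X =
    map′ (λ (c , good) → finToFun c , good)
         (λ (f , good) → funToFin f , λ i (C , inside , unb) →
            good i (C , All.map (λ (x , eq) → x , trans (sym (Fin.finToFun-funToFin f _)) eq) inside , unb))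
         (Fin.any? {n = k ^ order} λ c → isColouring? X (finToFun c))

  colourable-⊆ : Y ⊆ˢ X → Colourable k X → Colourable k Y
  colourable-⊆ Y⊆X (f , good) =
    f , λ i (C , inside , unb) → good i (C , All.map (λ (y , eq) → Y⊆X y , eq) inside , unb)

  colourable-≤ : k ≤ m → Colourable k X → Colourable m X
  colourable-≤ k≤m (f , good) =
    (λ v → inject≤ (f v) k≤m) , λ i (C , inside , unb) →
    let _ , base≡ = All-base C inside in
    good _ (C , All.map (λ (x , eq) → x , Fin.inject≤-injective k≤m k≤m _ _ (trans eq (sym base≡))) inside , unb)

  singleton-colourable : ∀ x → Colourable (suc k) ⁅ x ⁆
  singleton-colourable x = (λ _ → zero) , λ i (C , inside , _) →
    no-cycle (Cycle.walk C) (Cycle.nonempty C) inside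
    where
    no-cycle : ∀ {b} {P : V D → Set} (w : Walk D b b) → 0 < length (arcs w) → ¬ All (λ v → v ≡ x × P v) (tails w)
    no-cycle (arc e ◅ ε)     _ _                                   = loopless _ e
    no-cycle (arc e ◅ f ◅ w) _ ((refl , _) ∷ (refl , _) ∷ _) = loopless _ e

  inhabited : ¬ Colourable (suc k) X → ∃ (_∈ˢ X)
  inhabited {X = X} ¬col = decidable-stable (Fin.any? (mem? X)) λ none →
    ¬col ((λ _ → zero) , λ i (C , inside , _) → none (_ , proj₁ (All-base C inside)))

  -- A total choice of colourings, with the junk value zero on sets that are
  -- not colourable.
  colouring : ∀ k → VertexSet D → V D → Fin (suc k)
  colouring k X with colourable? (suc k) X
  ... | yes (f , _) = f
  ... | no _        = λ _ → zero

  colouring-isColouring : Colourable (suc k) X → IsColouring X (colouring k X)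
  colouring-isColouring {k} {X} col with colourable? (suc k) X
  ... | yes (_ , good) = good
  ... | no ¬col        = contradiction col ¬col

  level : (V D → ℕ) → VertexSet D → ℕ → VertexSet D
  level ℓ X j = X ∩ (λ v → ℓ v ≟ j)

  -- A cycle on which p is constant stays in one level, so p and colourings of
  -- the levels combine to a colouring of X.
  levels-bound :
    {_≼_ : Rel ℕ 0ℓ} → IsPartialOrder _≡_ _≼_ →
    (p : V D → Fin n) (ℓ : V D → ℕ) →
    (∀ {u v} → D ∋ u ⟶ v → u ∈ˢ X → v ∈ˢ X → p u ≡ p v → ℓ u ≼ ℓ v) →
    ¬ Colourable (n * suc m) X → ∃[ j ] ¬ Colourable (suc m) (level ℓ X j)
  levels-bound {n} {X} {m} po p ℓ step ¬col
    with Fin.any? (λ v → ¬? (colourable? (suc m) (level ℓ X (ℓ v))))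
  ... | yes (v , ¬colᵥ) = ℓ v , ¬colᵥ
  ... | no none = contradiction ((λ v → combine (p v) (local v)) , good) ¬col
    where
    local : V D → Fin (suc m)
    local v = colouring m (level ℓ X (ℓ v)) v

    good : IsColouring X (λ v → combine (p v) (local v))
    good i (C , inside , unb) =
      colouring-isColouring
        (decidable-stable (colourable? (suc m) (level ℓ X (ℓ b))) (λ ¬c → none (b , ¬c)))
        (local b)
        (C , All.map same-class (All.zip (inside , constant)) , unb)
      where
      b = Cycle.base C
      same : ∀ {v} → combine (p v) (local v) ≡ i → p v ≡ p b × local v ≡ local b
      same eq = Fin.combine-injective _ _ _ _ (trans eq (sym (proj₂ (All-base C inside))))
      constant : C InInduced (λ v → ℓ v ≡ ℓ b)
      constant = cycle-constant po ℓ {λ v → v ∈ˢ X × p v ≡ p b}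
        (λ e (x , px) (y , py) → step e x y (trans px (sym py))) C
        (All.map (λ (x , eq) → x , proj₁ (same eq)) inside)
      same-class : ∀ {v} → (v ∈ˢ X × combine (p v) (local v) ≡ i) × ℓ v ≡ ℓ b →
                   v ∈ˢ level ℓ X (ℓ b) × colouring m (level ℓ X (ℓ b)) v ≡ local b
      same-class {v} ((x , eq) , ℓ≡) =
        (x , ℓ≡) , trans (cong (λ j → colouring m (level ℓ X j) v) (sym ℓ≡)) (proj₂ (same eq))

  -- The class index is constant along arcs inside a class, so it can serve as its own level
  -- function.
  classes-bound : (p : V D → Fin n) → ¬ Colourable (n * suc m) X →
                  ∃[ j ] ¬ Colourable (suc m) (level (toℕ ∘ p) X j)
  classes-bound p = levels-bound ℕ.≤-isPartialOrder p (toℕ ∘ p) (λ _ _ _ → ℕ.≤-reflexive ∘ cong toℕ)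

  side : {P : Set} → Dec P → Fin 2
  side (yes _) = zero
  side (no  _) = suc zero

  -- The two classes are the parts of `X` inside and outside `Y`; one of them must fail with half
  -- the colours.
  difference-bound : ∀ Y → ¬ Colourable (2 * suc m) X → Colourable (suc m) Y → ¬ Colourable (suc m) (X ∖ Y)
  difference-bound {X = X} Y ¬col colY col∖ with classes-bound (λ v → side (mem? Y v)) ¬col
  ... | zero  , ¬colⱼ = ¬colⱼ (colourable-⊆ (λ (_ , eq) → in-Y (mem? Y _) eq) colY)
    where
    in-Y : ∀ {P : Set} (d : Dec P) → toℕ (side d) ≡ 0 → P
    in-Y (yes p) _ = p
  ... | suc j , ¬colⱼ = ¬colⱼ (colourable-⊆ (λ (x , eq) → x , out-Y (mem? Y _) eq) col∖)
    where
    out-Y : ∀ {P : Set} (d : Dec P) → toℕ (side d) ≡ suc j → ¬ P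
    out-Y (no ¬p) _ = ¬p

  -- Colourability passes to subsets, so testing the deletion of single vertices amounts to
  -- minimality under inclusion.
  Critical : ℕ → VertexSet D → Set
  Critical k X = ¬ Colourable k X × (∀ {v} → v ∈ˢ X → Colourable k (X ∖ ⁅ v ⁆))

  -- One pass of greedy deletion suffices: a vertex whose removal makes the set colourable has this
  -- property in every later subset too.
  critical-subset : ¬ Colourable k X → ∃[ Y ] Y ⊆ˢ X × Critical k Y
  critical-subset {k} {X} ¬col =
    let Y , Y⊆X , ¬colY , crit = go X ¬col (allFin order) in
    Y , Y⊆X , ¬colY , λ {v} → crit (∈.∈-allFin v)
    where
    go : ∀ X → ¬ Colourable k X → (vs : List (V D)) →
         ∃[ Y ] Y ⊆ˢ X × ¬ Colourable k Y × (∀ {v} → v ∈ vs → v ∈ˢ Y → Colourable k (Y ∖ ⁅ v ⁆))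
    go X ¬col []       = X , (λ x → x) , ¬col , λ ()
    go X ¬col (v ∷ vs) with colourable? k (X ∖ ⁅ v ⁆)
    ... | yes col =
      let Y , Y⊆X , ¬colY , crit = go X ¬col vs in
      Y , Y⊆X , ¬colY , λ where
        (here refl) y → colourable-⊆ (λ (y , ≢v) → Y⊆X y , ≢v) col
        (there i)   y → crit i y
    ... | no ¬col′ =
      let Y , Y⊆X , ¬colY , crit = go (X ∖ ⁅ v ⁆) ¬col′ vs in
      Y , proj₁ ∘ Y⊆X , ¬colY , λ where
        (here refl) y → contradiction refl (proj₂ (Y⊆X y))
        (there i)   y → crit i y

  -- Cycles stay within the levels of a monotone function, so some level `j` is not colourable. A
  -- vertex outside that level could be deleted without affecting it, against criticality.
  critical-constant :
    Critical (suc m) X → (ℓ : V D → ℕ) →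
    (∀ {u v} → D ∋ u ⟶ v → u ∈ˢ X → v ∈ˢ X → ℓ u ≤ ℓ v) →
    ∀ {u v} → u ∈ˢ X → v ∈ˢ X → ℓ u ≡ ℓ v
  critical-constant {m} {X} (¬col , crit) ℓ step
    with levels-bound {n = 1} {m = m} ℕ.≤-isPartialOrder (λ _ → zero) ℓ (λ e u v _ → step e u v)
           (subst (λ k → ¬ Colourable k X) (sym (ℕ.*-identityˡ (suc m))) ¬col)
  ... | j , ¬colⱼ = λ u v → trans (in-level u) (sym (in-level v))
    where
    in-level : ∀ {v} → v ∈ˢ X → ℓ v ≡ j
    in-level {v} v∈X = decidable-stable (ℓ v ≟ j) λ ≢j →
      ¬colⱼ (colourable-⊆ (λ (x , eq) → x , λ { refl → ≢j eq }) (crit v∈X))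

-- Strong connectivity and distance levels.

parity : ℕ → Fin 2
parity zero    = zero
parity (suc n) = opposite (parity n)

parity-suc : ∀ n → parity (suc n) ≢ parity n
parity-suc n = go (parity n)
  where
  go : ∀ i → opposite i ≢ i
  go zero       ()
  go (suc zero) ()

≤1+-same-parity : ∀ {m n} → n ℕ.≤ suc m → parity m ≡ parity n → n ℕ.≤ m
≤1+-same-parity {m} n≤1+m eq with ℕ.m≤n⇒m<n∨m≡n n≤1+m
... | inj₁ n<1+m = ℕ.≤-pred n<1+m
... | inj₂ refl  = contradiction (sym eq) (parity-suc m)

module Connections (D : Digraph) (Z₁ Z₂ : ArcSet D) where
  open Digraph D using (order; loopless)
  open import Data.Nat using (_*_; _≤_; _<_)
  open Colourings D Z₁ Z₂

  private
    variable
      k m n : ℕ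
      u v x : V D
      X Y : VertexSet D

  ends-distinct : D ∋ u ⟶ v → u ≢ v
  ends-distinct (arc e) refl = loopless _ e

  Within : VertexSet D → V D → V D → ℕ → Set
  Within X u v k = ∃[ w ] length (tails {D} {u} {v} w) ≡ k × All (_∈ˢ X) (vertices w)

  within? : ∀ X u v → Decidable (Within X u v)
  within? X u v k = anyWalk? k (λ w → All.all? (mem? X) (vertices w))

  -- Erasing loops bounds the length by the number of vertices, which leaves a finite search.
  reachable? : ∀ X u v → Dec (∃ (Within X u v))
  reachable? X u v =
    map′ (λ (k , _ , w) → k , w)
         (λ (_ , w , _ , inX) → let w′ , path′ , incl = erase w in
            _ , path-length w′ path′ , w′ , refl , All.tabulate (All.lookup inX ∘ incl))
         (ℕ.anyUpTo? (within? X u v) order)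

  within-∷ : D ∋ u ⟶ v → u ∈ˢ X → Within X v x k → Within X u x (suc k)
  within-∷ e u∈X (w , eq , inX) = e ◅ w , cong suc eq , u∈X ∷ inX

  within-∷ʳ : Within X u v k → D ∋ v ⟶ x → x ∈ˢ X → Within X u x (suc k)
  within-∷ʳ {X = X} {v = v} {x = x} (w , refl , inX) e x∈X = snoc w inX
    where
    snoc : ∀ {u} (w : Walk D u v) → All (_∈ˢ X) (vertices w) → Within X u x (suc (length (tails w)))
    snoc ε       (v∈X ∷ []) = e ◅ ε , refl , v∈X ∷ x∈X ∷ []
    snoc (f ◅ w) (u∈X ∷ in′) = within-∷ {X = X} f u∈X (snoc w in′)

  -- Give value 0 to the vertices that reach `v` and 1 to the others. No arc inside `X` decreases
  -- this value, so it is constant on `X`, and at `v` it is 0.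
  critical-strong : Critical (suc m) X → u ∈ˢ X → v ∈ˢ X → ∃ (Within X u v)
  critical-strong {X = X} {v = v} crit u∈X v∈X =
    zero-side (reaches? _) (trans (critical-constant crit (toℕ ∘ side ∘ reaches?) step u∈X v∈X)
                                  (side-zero (reaches? v) (0 , ε , refl , v∈X ∷ [])))
    where
    reaches? = λ u → reachable? X u v
    zero-side : ∀ {P : Set} (d : Dec P) → toℕ (side d) ≡ 0 → P
    zero-side (yes p) _ = p
    side-zero : ∀ {P : Set} (d : Dec P) → P → toℕ (side d) ≡ 0
    side-zero (yes _) _ = refl
    side-zero (no ¬p) p = contradiction p ¬p
    step : ∀ {x y} → D ∋ x ⟶ y → x ∈ˢ X → y ∈ˢ X → toℕ (side (reaches? x)) ≤ toℕ (side (reaches? y))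
    step {x} {y} e x∈X _ with reaches? x | reaches? y
    ... | yes _  | _     = z≤n
    ... | no _   | no _  = s≤s z≤n
    ... | no ¬rx | yes (_ , w) = contradiction (_ , within-∷ {X = X} e x∈X w) ¬rx

  minimum : {W : V D → ℕ → Set} → (∀ v → Decidable (W v)) → (∀ {v} → v ∈ˢ X → ∃ (W v)) →
            Σ[ ℓ ∈ (V D → ℕ) ] (∀ {v} → v ∈ˢ X → IsLeast (W v) (ℓ v))
  minimum {X} {W} W? some = ℓ , isLeast
    where
    ℓ : V D → ℕ
    ℓ v with mem? X v
    ... | yes v∈X = proj₁ (least (W? v) _ (proj₂ (some v∈X)))
    -- A default value; only vertices of `X` are ever measured.
    ... | no  _   = 0
    isLeast : ∀ {v} → v ∈ˢ X → IsLeast (W v) (ℓ v)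
    isLeast {v} v∈X with mem? X v
    ... | yes v∈X = proj₂ (least (W? v) _ (proj₂ (some v∈X)))
    ... | no  v∉X = contradiction v∈X v∉X

  DistanceFrom DistanceTo : VertexSet D → V D → (V D → ℕ) → Set
  DistanceFrom X x ℓ = ∀ {v} → v ∈ˢ X → IsLeast (Within X x v) (ℓ v)
  DistanceTo   X x ℓ = ∀ {v} → v ∈ˢ X → IsLeast (λ k → Within X v x k) (ℓ v)

  distance-from : Critical (suc m) X → x ∈ˢ X → ∃ (DistanceFrom X x)
  distance-from {X = X} {x} crit x∈X = minimum {X = X} (within? X x) (critical-strong crit x∈X)

  distance-to : Critical (suc m) X → x ∈ˢ X → ∃ (DistanceTo X x)
  distance-to {X = X} {x} crit x∈X = minimum {X = X} (λ v → within? X v x) (λ v∈X → critical-strong crit v∈X x∈X)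

  -- An arc leads at most one level up, so within the even (odd) levels it
  -- does not lead up at all.
  out-level : ∀ {ℓ} → DistanceFrom X x ℓ → Y ⊆ˢ X → ¬ Colourable (2 * suc m) Y →
              ∃[ j ] ¬ Colourable (suc m) (level ℓ Y j)
  out-level {X = X} {ℓ = ℓ} dist Y⊆X =
    levels-bound (Flip.isPartialOrder ℕ.≤-isPartialOrder) (parity ∘ ℓ) ℓ λ e u∈Y v∈Y →
      ≤1+-same-parity (proj₂ (dist (Y⊆X v∈Y)) _ (within-∷ʳ {X = X} (proj₁ (dist (Y⊆X u∈Y))) e (Y⊆X v∈Y)))

  -- Dually, an arc lowers the distance to `x` by at most one, so between levels of equal parity it
  -- never leads down.
  in-level : ∀ {ℓ} → DistanceTo X x ℓ → Y ⊆ˢ X → ¬ Colourable (2 * suc m) Y →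
             ∃[ j ] ¬ Colourable (suc m) (level ℓ Y j)
  in-level {X = X} {ℓ = ℓ} dist Y⊆X =
    levels-bound ℕ.≤-isPartialOrder (parity ∘ ℓ) ℓ λ e u∈Y v∈Y →
      ≤1+-same-parity (proj₂ (dist (Y⊆X u∈Y)) _ (within-∷ {X = X} e (Y⊆X u∈Y) (proj₁ (dist (Y⊆X v∈Y))))) ∘ sym

  -- The suffix of a shortest walk from one of its vertices competes for the distance of that
  -- vertex.
  shortest-to : ∀ {ℓ} → DistanceTo X x ℓ → u ∈ˢ X →
                Σ[ w ∈ Walk D u x ] (∀ {y} → y ∈ vertices w → y ∈ˢ X × (y ≡ u ⊎ ℓ y < ℓ u))
  shortest-to {X} {x} {u} {ℓ} dist u∈X with proj₁ (dist u∈X)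
  ... | w , len , inX = w , λ i → All.lookup inX i , closer i
    where
    closer : ∀ {y} → y ∈ vertices w → y ≡ u ⊎ ℓ y < ℓ u
    closer i with suffix w i
    ... | _  , _    , _ , _ , inj₁ eq = inj₁ eq
    ... | w′ , incl , _ , _ , inj₂ lt =
      inj₂ (ℕ.≤-<-trans (proj₂ (dist (All.lookup inX i)) _ (w′ , refl , All.tabulate (All.lookup inX ∘ incl)))
                        (subst (_ <_) len lt))

  shortest-from : ∀ {ℓ} → DistanceFrom X x ℓ → v ∈ˢ X →
                  Σ[ w ∈ Walk D x v ] (∀ {y} → y ∈ vertices w → y ∈ˢ X × (y ≡ v ⊎ ℓ y < ℓ v))
  shortest-from {X} {x} {v} {ℓ} dist v∈X with proj₁ (dist v∈X)
  ... | w , len , inX = w , λ i → All.lookup inX i , closer i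
    where
    closer : ∀ {y} → y ∈ vertices w → y ≡ v ⊎ ℓ y < ℓ v
    closer i with prefix w i
    ... | _  , _    , inj₁ eq = inj₁ eq
    ... | w′ , incl , inj₂ lt =
      inj₂ (ℕ.≤-<-trans (proj₂ (dist (All.lookup inX i)) _ (w′ , refl , All.tabulate (All.lookup inX ∘ incl)))
                        (subst (_ <_) len lt))

  -- Links through an outer layer, and switches.

  Through : VertexSet D → Walk D u v → Set
  Through {u} {v} X w = ∀ {y} → y ∈ vertices w → y ≡ u ⊎ y ≡ v ⊎ y ∈ˢ X

  Linked : VertexSet D → V D → V D → Set
  Linked X u v = Σ[ w ∈ Walk D u v ] IsPath w × Through X w

  -- A shortest walk to the root is followed by a shortest walk from it, and loops are erased.
  -- Vertices of the first half decrease `ℓ⁻`, those of the second have smaller `ℓ⁺` than `v`.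
  link-via-root :
    ∀ {ℓ⁻ ℓ⁺} → DistanceTo X x ℓ⁻ → DistanceFrom X x ℓ⁺ → u ∈ˢ X → v ∈ˢ X →
    Σ[ w ∈ Walk D u v ] IsPath w ×
      (∀ {y} → y ∈ vertices w → y ≡ u ⊎ y ≡ v ⊎ (y ∈ˢ X × (ℓ⁻ y < ℓ⁻ u ⊎ ℓ⁺ y < ℓ⁺ v)))
  link-via-root {X = X} {u = u} {v = v} {ℓ⁻} {ℓ⁺} to from u∈ v∈
    with shortest-to {X = X} to u∈ | shortest-from {X = X} from v∈
  ... | p , on-p | q , on-q with erase (p ◅◅ q)
  ... | w , path′ , incl = w , path′ , λ z∈ → [ through-p , through-q ]′ (∈-◅◅⁻ p (incl z∈))
    where
    through-p : ∀ {z} → z ∈ vertices p → z ≡ u ⊎ z ≡ v ⊎ (z ∈ˢ X × (ℓ⁻ z < ℓ⁻ u ⊎ ℓ⁺ z < ℓ⁺ v))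
    through-p z∈p with on-p z∈p
    ... | _  , inj₁ eq = inj₁ eq
    ... | z∈ , inj₂ lt = inj₂ (inj₂ (z∈ , inj₁ lt))
    through-q : ∀ {z} → z ∈ vertices q → z ≡ u ⊎ z ≡ v ⊎ (z ∈ˢ X × (ℓ⁻ z < ℓ⁻ u ⊎ ℓ⁺ z < ℓ⁺ v))
    through-q z∈q with on-q z∈q
    ... | _  , inj₁ eq = inj₂ (inj₁ eq)
    ... | z∈ , inj₂ lt = inj₂ (inj₂ (z∈ , inj₂ lt))

  -- `Y` lies in one level of each distance function, so a vertex strictly nearer than an end of the
  -- link, in either sense, is outside `Y`. Each factor 2 pays for the parity of one level.
  linked-subset : ¬ Colourable (2 * (2 * suc m)) X →
                  ∃[ Y ] Y ⊆ˢ X × ¬ Colourable (suc m) Y ×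
                    (∀ {u v} → u ∈ˢ Y → v ∈ˢ Y → u ≢ v → Linked (X ∖ Y) u v)
  linked-subset {m} {X} ¬col =
    case critical-subset ¬col of λ { (X₀ , X₀⊆X , crit) →
    case inhabited (proj₁ crit) of λ { (x , x∈X₀) →
    case distance-from {X = X₀} crit x∈X₀ of λ { (ℓ⁺ , from) →
    case distance-to {X = X₀} crit x∈X₀ of λ { (ℓ⁻ , to) →
    case out-level {X = X₀} from (λ v → v) (proj₁ crit) of λ { (j , ¬col⁺) →
    case in-level {X = X₀} to proj₁ ¬col⁺ of λ { (i , ¬col⁻) →
    level ℓ⁻ (level ℓ⁺ X₀ j) i , X₀⊆X ∘ proj₁ ∘ proj₁ , ¬col⁻ ,
    λ { {u} {v} ((u∈ , _) , ℓ⁻u) ((v∈ , ℓ⁺v) , _) u≢v →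
    case link-via-root {X = X₀} to from u∈ v∈ of λ { (w , path′ , through) →
    w , path′ , λ z∈ → case through z∈ of λ where
      (inj₁ eq)        → inj₁ eq
      (inj₂ (inj₁ eq)) → inj₂ (inj₁ eq)
      (inj₂ (inj₂ (z∈ , inj₁ lt))) → inj₂ (inj₂ (X₀⊆X z∈ , λ (_ , eq) → ℕ.<-irrefl (trans eq (sym ℓ⁻u)) lt))
      (inj₂ (inj₂ (z∈ , inj₂ lt))) → inj₂ (inj₂ (X₀⊆X z∈ , λ ((_ , eq) , _) → ℕ.<-irrefl (trans eq (sym ℓ⁺v)) lt))
    }}}}}}}}

  unbalanced-cycle : ¬ Colourable 1 X → ∃[ C ] C InInduced (_∈ˢ X) × Unbalanced Z₁ Z₂ C
  unbalanced-cycle {X} ¬col =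
    decidable-stable (anyCycle? λ w → All.all? (mem? X) (tails w) ×-dec ¬? (∣ w ∩ Z₁ ∣ ≟ ∣ w ∩ Z₂ ∣)) λ none →
      ¬col ((λ _ → zero) , λ i (C , inside , unb) → none (C , All.map proj₁ inside , unb))

  -- Leaving `S` from `near`, or crossing `edge` first and leaving from `far`, gives two routes. As
  -- the approach avoids `far`, crossing `edge` repeats no vertex.
  record Switch (S : VertexSet D) (s : V D) : Set where
    field
      {near far} : V D
      approach   : Walk D s near
      isPath     : IsPath approach
      inside     : ∀ {y} → y ∈ vertices approach → y ∈ˢ S
      far∉       : far ∉ vertices approach
      far∈       : far ∈ˢ S
      edge       : D ∋ near ⟶ far
      different  : Z₁ (near , far , edge) ≢ Z₂ (near , far , edge)

  -- Some distance level from `x` is not 1-colourable, so it contains an unbalanced cycle and on it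
  -- an arc in exactly one of `Z₁` and `Z₂`. Both ends of this arc are at the same distance, so a
  -- shortest path to its tail cannot meet its head.
  switch : Critical 2 X → x ∈ˢ X → Switch X x
  switch {X} {x} crit x∈X =
    case distance-from {X = X} crit x∈X of λ { (ℓ , from) →
    case out-level {X = X} {m = 0} from (λ v → v) (proj₁ crit) of λ { (j , ¬col) →
    case unbalanced-cycle {level ℓ X j} ¬col of λ { (C , inside , unb) →
    case arc-where-different Z₁ Z₂ {_∈ˢ level ℓ X j} (Cycle.walk C) inside (All-base C inside) unb
    of λ { (s , t , e , (s∈ , ℓs) , (t∈ , ℓt) , different) →
    case shortest-from {X = X} from s∈ of λ { (w , on-w) →
    case erase w of λ { (w′ , path′ , incl) → record
      { approach  = w′
      ; isPath    = path′
      ; inside    = proj₁ ∘ on-w ∘ incl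
      ; far∉      = λ i → case proj₂ (on-w (incl i)) of λ where
          (inj₁ t≡s) → ends-distinct e (sym t≡s)
          (inj₂ lt)  → ℕ.<-irrefl (trans ℓt (sym ℓs)) lt
      ; far∈      = t∈
      ; edge      = e
      ; different = different
      } }}}}}}

-- Congruence of integers.

module Congruence (q : ℤ) where
  open import Data.Integer using (_+_; _*_; _-_; -_)

  -- A wrapper of congruence modulo q from which x and y can be inferred.
  infix 4 _≈_
  record _≈_ (x y : ℤ) : Set where
    constructor congruent
    field difference-divisible : x ≡ y [mod q ]

  open _≈_ public

  ≈-refl : ∀ {x} → x ≈ x
  ≈-refl {x} = congruent (divides 0ℤ (ℤ.+-inverseʳ x))

  ≈-reflexive : ∀ {x y} → x ≡ y → x ≈ y
  ≈-reflexive refl = ≈-refl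

  ≈-sym : ∀ {x y} → x ≈ y → y ≈ x
  ≈-sym {x} {y} (congruent q∣x-y) = congruent (subst (q ∣_) (negated x y) (∣m⇒∣-m q∣x-y))
    where
    negated : ∀ x y → - (x - y) ≡ y - x
    negated = solve-∀

  ≈-trans : ∀ {x y z} → x ≈ y → y ≈ z → x ≈ z
  ≈-trans {x} {y} {z} (congruent xy) (congruent yz) =
    congruent (subst (q ∣_) (telescope x y z) (∣m∣n⇒∣m+n xy yz))
    where
    telescope : ∀ x y z → (x - y) + (y - z) ≡ x - z
    telescope = solve-∀

  +-cong : ∀ {x x′ y y′} → x ≈ x′ → y ≈ y′ → x + y ≈ x′ + y′
  +-cong {x} {x′} {y} {y′} (congruent xx) (congruent yy) =
    congruent (subst (q ∣_) (regroup x x′ y y′) (∣m∣n⇒∣m+n xx yy))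
    where
    regroup : ∀ x x′ y y′ → (x - x′) + (y - y′) ≡ (x + y) - (x′ + y′)
    regroup = solve-∀

  *-congˡ : ∀ z {x y} → x ≈ y → z * x ≈ z * y
  *-congˡ z {x} {y} (congruent xy) = congruent (subst (q ∣_) (distrib z x y) (∣n⇒∣m*n z xy))
    where
    distrib : ∀ z x y → z * (x - y) ≡ z * x - z * y
    distrib = solve-∀

module _ (n : ℕ) .{{_ : ℕ.NonZero n}} where
  open import Data.Integer using (_+_; _*_; _-_; _%ℕ_; _/ℕ_)
  open Congruence (+ n)

  ≈-%ℕ : ∀ x → x ≈ + (x %ℕ n)
  ≈-%ℕ x = congruent (divides (x /ℕ n) (begin
    x - r                     ≡⟨ cong (_- r) (ℤ.a≡a%ℕn+[a/ℕn]*n x n) ⟩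
    r + x /ℕ n * + n - r      ≡⟨ cancel r (x /ℕ n * + n) ⟩
    x /ℕ n * + n              ∎))
    where
    open ≡-Reasoning
    r = + (x %ℕ n)
    cancel : ∀ r s → r + s - r ≡ s
    cancel = solve-∀

-- Detours with a short and a long version.

detourBound : ℕ → ℕ → ℕ
detourBound p k = 2 ℕ.* (2 ℕ.* (2 ℕ.* (2 ℕ.* (2 ℕ.* (suc p ℕ.* (2 ℕ.* (4 ℕ.+ k)))))))

-- p is the modulus minus one.
module Weights (D : Digraph) (Z₁ Z₂ : ArcSet D) (a b : ℤ) (p : ℕ) where
  open Colourings D Z₁ Z₂
  open Connections D Z₁ Z₂
  open import Data.Integer using (_+_; _*_)
  open Congruence (+ suc p)

  private
    variable
      k m n : ℕ
      u v x : V D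
      c d : ℤ
      X Y : VertexSet D

  weight : Walk D u v → ℤ
  weight w = a * + ∣ w ∩ Z₁ ∣ + b * + ∣ w ∩ Z₂ ∣

  count-◅◅ : ∀ Z (w : Walk D u v) (w′ : Walk D v x) → ∣ w ◅◅ w′ ∩ Z ∣ ≡ ∣ w ∩ Z ∣ ℕ.+ ∣ w′ ∩ Z ∣
  count-◅◅ Z w w′ = begin
    length (filterᵇ Z (arcs (w ◅◅ w′)))                      ≡⟨ cong (length ∘ filterᵇ Z) (arcs-◅◅ w w′) ⟩
    length (filterᵇ Z (arcs w ++ arcs w′))                   ≡⟨ cong length (List.filter-++ (T? ∘ Z) (arcs w) _) ⟩
    length (filterᵇ Z (arcs w) ++ filterᵇ Z (arcs w′))       ≡⟨ List.length-++ (filterᵇ Z (arcs w)) ⟩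
    ∣ w ∩ Z ∣ ℕ.+ ∣ w′ ∩ Z ∣                                 ∎
    where open ≡-Reasoning

  weight-◅◅ : (w : Walk D u v) (w′ : Walk D v x) → weight (w ◅◅ w′) ≡ weight w + weight w′
  weight-◅◅ w w′
    rewrite count-◅◅ Z₁ w w′ | count-◅◅ Z₂ w w′
          | ℤ.pos-+ ∣ w ∩ Z₁ ∣ ∣ w′ ∩ Z₁ ∣ | ℤ.pos-+ ∣ w ∩ Z₂ ∣ ∣ w′ ∩ Z₂ ∣ =
    regroup a b (+ ∣ w ∩ Z₁ ∣) (+ ∣ w′ ∩ Z₁ ∣) (+ ∣ w ∩ Z₂ ∣) (+ ∣ w′ ∩ Z₂ ∣)
    where
    regroup : ∀ a b k k′ l l′ → a * (k + k′) + b * (l + l′) ≡ (a * k + b * l) + (a * k′ + b * l′)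
    regroup = solve-∀

  weight-different : (e : D ∋ u ⟶ v) → Z₁ (u , v , e) ≢ Z₂ (u , v , e) →
                     weight (e ◅ ε) ≡ a ⊎ weight (e ◅ ε) ≡ b
  weight-different {u} {v} e different with Z₁ (u , v , e) | Z₂ (u , v , e)
  ... | true  | true  = contradiction refl different
  ... | false | false = contradiction refl different
  ... | true  | false = inj₁ (first a b)
    where
    first : ∀ a b → a * + 1 + b * + 0 ≡ a
    first = solve-∀
  ... | false | true  = inj₂ (second a b)
    where
    second : ∀ a b → a * + 0 + b * + 1 ≡ b
    second = solve-∀

  -- The residues of the chosen witnesses split `X` into `p + 1` classes, one of which still needs
  -- many colours.
  equal-residues : {P : V D → Set} (f : ∀ {v} → P v → ℤ) → (∀ {v} → v ∈ˢ X → P v) →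
                   ¬ Colourable (suc p ℕ.* suc m) X →
                   ∃[ Y ] Y ⊆ˢ X × ¬ Colourable (suc m) Y × ∃[ c ] (∀ {v} → v ∈ˢ Y → Σ[ r ∈ P v ] f r ≈ c)
  equal-residues {X = X} {P = P} f some ¬col =
    case classes-bound (λ v → residue (mem? X v)) ¬col of λ { (j , ¬colⱼ) →
    level (λ v → toℕ (residue (mem? X v))) X j , proj₁ , ¬colⱼ , + j ,
    λ (v∈ , eq) → some-with-residue (mem? X _) v∈ eq }
    where
    residue : Dec (v ∈ˢ X) → Fin (suc p)
    residue (yes v∈) = fromℕ< (ℤ.n%ℕd<d (f (some v∈)) (suc p))
    -- A default value, never consulted on a level of `X`.
    residue (no _)   = zero
    some-with-residue : ∀ {j} (d : Dec (v ∈ˢ X)) → v ∈ˢ X → toℕ (residue d) ≡ j → Σ[ r ∈ P v ] f r ≈ + j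
    some-with-residue (yes v∈) _  refl =
      some v∈ , subst (λ k → f (some v∈) ≈ + k) (sym (Fin.toℕ-fromℕ< _)) (≈-%ℕ (suc p) (f (some v∈)))
    some-with-residue (no v∉)  v∈ _    = contradiction v∈ v∉

  record Detour (X Y : VertexSet D) (u x : V D) (d : ℤ) : Set where
    field
      short long      : Walk D u x
      short-isPath    : IsPath short
      long-isPath     : IsPath long
      short-through   : Through (X ∖ Y) short
      long-through    : Through (X ∖ Y) long
      difference      : weight long ≈ weight short + d

  -- One deleted vertex leaves a 2-colourable set, and the product colouring of the two pieces has 4
  -- colours.
  critical-2-colourable : Critical 2 X → Colourable 4 X
  critical-2-colourable {X} (¬col , crit) =
    case inhabited ¬col of λ { (x , x∈) →
    decidable-stable (colourable? 4 X) λ ¬col₄ →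
      difference-bound ⁅ x ⁆ ¬col₄ (singleton-colourable x) (crit x∈) }

  -- The factors of `detourBound`, from the outside: 4 for each of two nested linked sets, 2 for
  -- removing `x`, `p + 1` for equal residues of the ways back to `x`, and 2 for removing the
  -- 4-colourable set `S`.
  detour : ¬ Colourable (detourBound p k) X →
           ∃[ Y ] Y ⊆ˢ X × ¬ Colourable (4 ℕ.+ k) Y × Σ[ x ∈ V D ] x ∈ˢ X ∖ Y ×
             ((∀ u → u ∈ˢ Y → Detour X Y u x a) ⊎ (∀ u → u ∈ˢ Y → Detour X Y u x b))
  detour {k} {X} ¬col =
    case linked-subset ¬col of λ { (X′ , X′⊆X , ¬col′ , link′) →
    case linked-subset ¬col′ of λ { (X″ , X″⊆X′ , ¬col″ , link″) →
    case inhabited ¬col″ of λ { (x , x∈X″) →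
    case equal-residues {X = X″ ∖ ⁅ x ⁆} (λ (r : Linked (X′ ∖ X″) _ x) → weight (proj₁ r))
           (λ (v∈ , v≢x) → link″ v∈ x∈X″ v≢x)
           (difference-bound ⁅ x ⁆ ¬col″ (singleton-colourable x))
    of λ { (C , C⊆ , ¬colC , c , return) →
    case critical-subset (λ col → ¬colC (colourable-≤ (s≤s (s≤s z≤n)) col)) of λ { (S , S⊆C , critS) →
    case inhabited (proj₁ critS) of λ { (s₀ , s₀∈S) →
    build {X′} {X″} {C} {S} X′⊆X link′ X″⊆X′ x∈X″ (return ∘ S⊆C) (proj₁ ∘ C⊆) (proj₂ ∘ C⊆) S⊆C s₀∈S (switch critS s₀∈S)
      (difference-bound S ¬colC (colourable-≤ (s≤s (s≤s (s≤s (s≤s z≤n)))) (critical-2-colourable critS)))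
    }}}}}}
    where
    -- The pieces lie in disjoint layers: the link from `u` to `s₀` has its interior outside `X′`,
    -- the approach stays in `S`, and the way back to `x` has its interior in `X′` but outside `X″`.
    -- Hence the concatenations are paths.
    build : ∀ {X′ X″ C S c x s₀} →
            X′ ⊆ˢ X → (∀ {u v} → u ∈ˢ X′ → v ∈ˢ X′ → u ≢ v → Linked (X ∖ X′) u v) →
            X″ ⊆ˢ X′ → x ∈ˢ X″ →
            (∀ {v} → v ∈ˢ S → Σ[ r ∈ Linked (X′ ∖ X″) v x ] weight (proj₁ r) ≈ c) →
            C ⊆ˢ X″ → (∀ {v} → v ∈ˢ C → v ≢ x) → S ⊆ˢ C → s₀ ∈ˢ S → Switch S s₀ →
            ¬ Colourable (4 ℕ.+ k) (C ∖ S) →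
            ∃[ Y ] Y ⊆ˢ X × ¬ Colourable (4 ℕ.+ k) Y × Σ[ x ∈ V D ] x ∈ˢ X ∖ Y ×
              ((∀ u → u ∈ˢ Y → Detour X Y u x a) ⊎ (∀ u → u ∈ˢ Y → Detour X Y u x b))
    build {X′} {X″} {C} {S} {c} {x} {s₀} X′⊆X link′ X″⊆X′ x∈X″ return C⊆X″ ≢x S⊆C s₀∈S sw ¬col =
      C ∖ S , X′⊆X ∘ C⊆X′ ∘ proj₁ , ¬col , x , (X′⊆X x∈X′ , λ (x∈C , _) → ≢x x∈C refl) ,
      [ (λ eq → inj₁ λ u → detour′ eq) , (λ eq → inj₂ λ u → detour′ eq) ]′ (weight-different edge different)
      where
      open Switch sw
      x∈X′ : x ∈ˢ X′
      x∈X′ = X″⊆X′ x∈X″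
      C⊆X′ : C ⊆ˢ X′
      C⊆X′ = X″⊆X′ ∘ C⊆X″
      S⊆X″ : S ⊆ˢ X″
      S⊆X″ = C⊆X″ ∘ S⊆C
      near∈ : near ∈ˢ S
      near∈ = inside (end∈ approach)
      home : ∀ {v} → v ∈ˢ S → Walk D v x
      home v∈ = proj₁ (proj₁ (return v∈))
      home-isPath : ∀ {v} (v∈ : v ∈ˢ S) → IsPath (home v∈)
      home-isPath v∈ = proj₁ (proj₂ (proj₁ (return v∈)))
      home-meets-S : ∀ {v y} (v∈ : v ∈ˢ S) → y ∈ vertices (home v∈) → y ∈ˢ S → y ≡ v
      home-meets-S v∈ i y∈ with proj₂ (proj₂ (proj₁ (return v∈))) i
      ... | inj₁ eq                 = eq
      ... | inj₂ (inj₁ refl)        = contradiction refl (≢x (S⊆C y∈))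
      ... | inj₂ (inj₂ (_ , y∉X″)) = contradiction (S⊆X″ y∈) y∉X″
      S⊆X′∖Y : S ⊆ˢ X′ ∖ (C ∖ S)
      S⊆X′∖Y y∈ = X″⊆X′ (S⊆X″ y∈) , λ (_ , y∉) → y∉ y∈
      home⊆ : ∀ {v y} (v∈ : v ∈ˢ S) → y ∈ vertices (home v∈) → y ∈ˢ X′ ∖ (C ∖ S)
      home⊆ v∈ i with proj₂ (proj₂ (proj₁ (return v∈))) i
      ... | inj₁ refl                = S⊆X′∖Y v∈
      ... | inj₂ (inj₁ refl)         = x∈X′ , λ (x∈C , _) → ≢x x∈C refl
      ... | inj₂ (inj₂ (y∈ , y∉X″)) = y∈ , λ (y∈C , _) → y∉X″ (C⊆X″ y∈C)

      short₀ long₀ : Walk D s₀ x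
      short₀ = approach ◅◅ home near∈
      long₀  = approach ◅◅ (edge ◅ home far∈)

      short₀-isPath : IsPath short₀
      short₀-isPath = ◅◅-isPath approach isPath (home-isPath near∈)
                        (λ i j → home-meets-S near∈ j (inside i))
      long₀-isPath : IsPath long₀
      long₀-isPath = ◅◅-isPath approach isPath
        (All.tabulate (λ { j refl → ends-distinct edge (home-meets-S far∈ j near∈) }) ∷ home-isPath far∈)
        λ { i (here eq) → eq
          ; i (there j) → contradiction (subst (_∈ vertices approach) (home-meets-S far∈ j (inside i)) i) far∉ }

      short₀⊆ : ∀ {y} → y ∈ vertices short₀ → y ∈ˢ X′ ∖ (C ∖ S)
      short₀⊆ i = [ S⊆X′∖Y ∘ inside , home⊆ near∈ ]′ (∈-◅◅⁻ approach i)
      long₀⊆ : ∀ {y} → y ∈ vertices long₀ → y ∈ˢ X′ ∖ (C ∖ S)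
      long₀⊆ i with ∈-◅◅⁻ approach i
      ... | inj₁ i            = S⊆X′∖Y (inside i)
      ... | inj₂ (here refl)  = S⊆X′∖Y near∈
      ... | inj₂ (there i)    = home⊆ far∈ i

      -- The ways back from `near` and `far` have equal residues, so only the weight of `edge`
      -- survives.
      difference₀ : weight (edge ◅ ε) ≡ d → weight long₀ ≈ weight short₀ + d
      difference₀ {d} eq =
        subst₂ _≈_ (sym (trans (weight-◅◅ approach _) (cong (_+_ (weight approach)) (weight-◅◅ (edge ◅ ε) (home far∈)))))
                   (trans (reorder (weight approach) d (weight (home near∈)))
                          (cong (_+ d) (sym (weight-◅◅ approach (home near∈)))))
          (+-cong {weight approach} ≈-refl
            (+-cong (≈-reflexive eq) (≈-trans (proj₂ (return far∈)) (≈-sym (proj₂ (return near∈))))))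
        where
        reorder : ∀ s d r → s + (d + r) ≡ s + r + d
        reorder = solve-∀

      detour′ : weight (edge ◅ ε) ≡ d → u ∈ˢ C ∖ S → Detour X (C ∖ S) u x d
      detour′ {d} {u} eq (u∈C , u∉S)
        with link′ (C⊆X′ u∈C) (C⊆X′ (S⊆C s₀∈S)) (λ { refl → u∉S s₀∈S })
      ... | l , l-isPath , l-through = record
        { short         = l ◅◅ short₀
        ; long          = l ◅◅ long₀
        ; short-isPath  = ◅◅-isPath l l-isPath short₀-isPath (λ i j → joint i (short₀⊆ j))
        ; long-isPath   = ◅◅-isPath l l-isPath long₀-isPath (λ i j → joint i (long₀⊆ j))
        ; short-through = λ i → [ before , (λ j → after (short₀⊆ j)) ]′ (∈-◅◅⁻ l i)
        ; long-through  = λ i → [ before , (λ j → after (long₀⊆ j)) ]′ (∈-◅◅⁻ l i)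
        ; difference    =
            subst₂ _≈_ (sym (weight-◅◅ l long₀))
                       (trans (sym (ℤ.+-assoc (weight l) (weight short₀) d)) (cong (_+ d) (sym (weight-◅◅ l short₀))))
              (+-cong {weight l} ≈-refl (difference₀ eq))
        }
        where
        joint : ∀ {y} → y ∈ vertices l → y ∈ˢ X′ ∖ (C ∖ S) → y ≡ s₀
        joint i (y∈ , y∉) with l-through i
        ... | inj₁ refl               = contradiction (u∈C , u∉S) y∉
        ... | inj₂ (inj₁ eq)          = eq
        ... | inj₂ (inj₂ (_ , y∉X′)) = contradiction y∈ y∉X′
        after : ∀ {y} → y ∈ˢ X′ ∖ (C ∖ S) → y ≡ u ⊎ y ≡ x ⊎ y ∈ˢ X ∖ (C ∖ S)
        after (y∈ , y∉) = inj₂ (inj₂ (X′⊆X y∈ , y∉))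
        before : ∀ {y} → y ∈ vertices l → y ≡ u ⊎ y ≡ x ⊎ y ∈ˢ X ∖ (C ∖ S)
        before i with l-through i
        ... | inj₁ eq                  = inj₁ eq
        ... | inj₂ (inj₁ refl)         = after (S⊆X′∖Y s₀∈S)
        ... | inj₂ (inj₂ (y∈ , y∉X′)) = inj₂ (inj₂ (y∈ , λ (y∈C , _) → y∉X′ (C⊆X′ y∈C)))

-- Units modulo q.

module _ (q : ℕ) where
  open import Data.Integer using (_+_; _*_; _-_; -_)
  open Congruence (+ q)

  -- Bézout for the absolute value of `a` and `q`; its two cases give the sign of the coefficient,
  -- and a negative `a` negates the inverse.
  invertible-mod : ∀ a → gcd a (+ q) ≡ 1ℤ → ∃[ x ] x * a ≈ 1ℤ
  invertible-mod a gcd≡1 = by-sign abs-invertible (ℤ.+∣i∣≡i⊎+∣i∣≡-i a)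
    where
    cast : ∀ {x y m n} → 1 ℕ.+ y ℕ.* n ≡ x ℕ.* m → + x * + m ≡ 1ℤ + + y * + n
    cast {x} {y} {m} {n} eq = begin
      + x * + m                ≡⟨ ℤ.pos-* x m ⟨
      + (x ℕ.* m)              ≡⟨ cong +_ eq ⟨
      + (1 ℕ.+ y ℕ.* n)        ≡⟨ ℤ.pos-+ 1 (y ℕ.* n) ⟩
      1ℤ + + (y ℕ.* n)         ≡⟨ cong (_+_ 1ℤ) (ℤ.pos-* y n) ⟩
      1ℤ + + y * + n           ∎
      where open ≡-Reasoning
    abs-invertible : ∃[ x ] x * + ℤ.∣ a ∣ ≈ 1ℤ
    abs-invertible with Coprimality.coprime-Bézout (Coprimality.gcd≡1⇒coprime {ℤ.∣ a ∣} {q} (ℤ.+-injective gcd≡1))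
    ... | ℕ.Bézout.+- x y eq =
      + x , congruent (divides (+ y) (trans (cong (_- 1ℤ) (cast {x} {y} eq)) (cancel (+ y * + q))))
      where
      cancel : ∀ z → 1ℤ + z - 1ℤ ≡ z
      cancel = solve-∀
    ... | ℕ.Bézout.-+ x y eq =
      - + x , congruent (divides (- + y)
        (trans (negated (+ x) (+ ℤ.∣ a ∣)) (trans (cong -_ (sym (cast {y} {x} eq))) (ℤ.neg-distribˡ-* (+ y) (+ q)))))
      where
      negated : ∀ x z → - x * z - 1ℤ ≡ - (1ℤ + x * z)
      negated = solve-∀
    by-sign : ∃[ x ] x * + ℤ.∣ a ∣ ≈ 1ℤ → + ℤ.∣ a ∣ ≡ a ⊎ + ℤ.∣ a ∣ ≡ - a → ∃[ x ] x * a ≈ 1ℤ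
    by-sign (x , inv) (inj₁ eq) = x , subst (λ z → x * z ≈ 1ℤ) eq inv
    by-sign (x , inv) (inj₂ eq) = - x , ≈-trans (≈-reflexive (trans (flip-sign x a) (cong (x *_) (sym eq)))) inv
      where
      flip-sign : ∀ x a → - x * a ≡ x * - a
      flip-sign = solve-∀

  multiple-congruent : .{{_ : ℕ.NonZero q}} → ∀ a r → gcd a (+ q) ≡ 1ℤ → ∃[ i ] i ℕ.< q × + i * a ≈ r
  multiple-congruent a r gcd≡1 =
    let x , inv = invertible-mod a gcd≡1
        -- As `x` inverts `a`, the integer `r * x` solves the congruence; reducing it gives a
        -- multiplier below `q`.
        i       = (r * x) ℤ.%ℕ q
    in i , ℤ.n%ℕd<d (r * x) q , solves x inv i (≈-%ℕ q (r * x))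
    where
    solves : ∀ x → x * a ≈ 1ℤ → ∀ i → r * x ≈ + i → + i * a ≈ r
    solves x inv i eq =
      ≈-trans (≈-reflexive (ℤ.*-comm (+ i) a))
      (≈-trans (*-congˡ a (≈-sym eq))
      (≈-trans (≈-reflexive (rotate a r x))
      (≈-trans (*-congˡ r inv) (≈-reflexive (ℤ.*-identityʳ r)))))
      where
      rotate : ∀ a r x → a * (r * x) ≡ r * (x * a)
      rotate = solve-∀

-- Links of prescribed residue.

flexibilityBound : ℕ → ℕ → ℕ → ℕ
flexibilityBound p zero    k = 2 ℕ.* (2 ℕ.* (4 ℕ.+ k))
flexibilityBound p (suc t) k = flexibilityBound p t (detourBound p k)

-- Twice the modulus many detours, so that one of the two kinds occurs at least as often as the
-- modulus.
linkBound : ℕ → ℕ → ℕ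
linkBound p = flexibilityBound p (suc p ℕ.+ suc p)

module LinksOfAnyResidue (D : Digraph) (Z₁ Z₂ : ArcSet D) (a b : ℤ) (p : ℕ) where
  open Colourings D Z₁ Z₂
  open Connections D Z₁ Z₂
  open Weights D Z₁ Z₂ a b p
  open import Data.Integer using (_+_; _*_; _-_)
  open Congruence (+ suc p)

  private
    variable
      m n : ℕ
      O O′ : ℤ → Set
      d : ℤ
      X Y : VertexSet D

  -- X is linked through Y ∖ X by paths whose weights, up to a shift depending
  -- on the ends, attain every offset in O.
  Flexible : VertexSet D → VertexSet D → (ℤ → Set) → Set
  Flexible Y X O = ∀ u v → u ∈ˢ X → v ∈ˢ X → u ≢ v →
    ∃[ c ] (∀ o → O o → Σ[ w ∈ Walk D u v ] IsPath w × Through (Y ∖ X) w × weight w ≈ c + o)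

  data WithDetour (d : ℤ) (O : ℤ → Set) : ℤ → Set where
    avoid : ∀ {o} → O o → WithDetour d O o
    take  : ∀ {o} → O o → WithDetour d O (d + o)

  -- The interior of the detour to `x` is in `X` but outside `X′`, that of the onward link outside
  -- `X`, so the two share only `x`. The short version keeps the offset and the long one adds `d`.
  with-detour : ∀ {Y X X′ x} → X ⊆ˢ Y → X′ ⊆ˢ X → x ∈ˢ X ∖ X′ →
                (∀ u → u ∈ˢ X′ → Detour X X′ u x d) →
                Flexible Y X O → Flexible Y X′ (WithDetour d O)
  with-detour {d} {O} {Y} {X} {X′} {x} X⊆Y X′⊆X (x∈X , x∉X′) detours flexible u v u∈ v∈ u≢v
    with detours u u∈ | flexible x v x∈X (X′⊆X v∈) (λ { refl → x∉X′ v∈ })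
  ... | δ | c , reach = weight short + c , λ where
      _ (avoid {o} O-o) → case reach o O-o of λ { (w , isPath , through , w≈) →
        short ◅◅ w , joined short-isPath short-through isPath through , joined-through short-through through ,
        ≈-trans (≈-reflexive (weight-◅◅ short w))
        (≈-trans (+-cong {weight short} ≈-refl w≈) (≈-reflexive (sym (ℤ.+-assoc (weight short) c o)))) }
      _ (take {o} O-o) → case reach o O-o of λ { (w , isPath , through , w≈) →
        long ◅◅ w , joined long-isPath long-through isPath through , joined-through long-through through ,
        ≈-trans (≈-reflexive (weight-◅◅ long w))
        (≈-trans (+-cong difference w≈) (≈-reflexive (regroup (weight short) d c o))) }
    where
    open Detour δ
    regroup : ∀ s d c o → (s + d) + (c + o) ≡ (s + c) + (d + o)
    regroup = solve-∀
    module _ {s : Walk D u x} {w : Walk D x v} where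
      joined : IsPath s → Through (X ∖ X′) s → IsPath w → Through (Y ∖ X) w → IsPath (s ◅◅ w)
      joined s-isPath s-through w-isPath w-through = ◅◅-isPath s s-isPath w-isPath λ i j → meet (s-through i) (w-through j)
        where
        meet : ∀ {y} → y ≡ u ⊎ y ≡ x ⊎ y ∈ˢ X ∖ X′ → y ≡ x ⊎ y ≡ v ⊎ y ∈ˢ Y ∖ X → y ≡ x
        meet (inj₂ (inj₁ eq))         _                       = eq
        meet _                        (inj₁ eq)               = eq
        meet (inj₁ refl)              (inj₂ (inj₁ refl))      = contradiction refl u≢v
        meet (inj₁ refl)              (inj₂ (inj₂ (_ , y∉X))) = contradiction (X′⊆X u∈) y∉X
        meet (inj₂ (inj₂ (_ , y∉X′))) (inj₂ (inj₁ refl))      = contradiction v∈ y∉X′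
        meet (inj₂ (inj₂ (y∈X , _)))  (inj₂ (inj₂ (_ , y∉X))) = contradiction y∈X y∉X
      joined-through : Through (X ∖ X′) s → Through (Y ∖ X) w → Through (Y ∖ X′) (s ◅◅ w)
      joined-through s-through w-through i with ∈-◅◅⁻ s i
      ... | inj₁ i = case s-through i of λ where
        (inj₁ eq)                  → inj₁ eq
        (inj₂ (inj₁ refl))         → inj₂ (inj₂ (X⊆Y x∈X , x∉X′))
        (inj₂ (inj₂ (y∈X , y∉X′))) → inj₂ (inj₂ (X⊆Y y∈X , y∉X′))
      ... | inj₂ i = case w-through i of λ where
        (inj₁ refl)              → inj₂ (inj₂ (X⊆Y x∈X , x∉X′))
        (inj₂ (inj₁ eq))         → inj₂ (inj₁ eq)
        (inj₂ (inj₂ (y∈ , y∉X))) → inj₂ (inj₂ (y∈ , y∉X ∘ X′⊆X))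

  flexible-⊆ : ∀ {Y X} → (∀ {o} → O′ o → O o) → Flexible Y X O → Flexible Y X O′
  flexible-⊆ O′⊆O flexible u v u∈ v∈ u≢v =
    let c , reach = flexible u v u∈ v∈ u≢v in c , λ o → reach o ∘ O′⊆O

  -- Long versions are taken from detours of a single kind; those of the other kind are passed by
  -- their short versions.
  data Multiple (m n : ℕ) : ℤ → Set where
    of-a : ∀ {i} → i ℕ.≤ m → Multiple m n (+ i * a)
    of-b : ∀ {j} → j ℕ.≤ n → Multiple m n (+ j * b)

  multiple-a-suc : ∀ {o} → Multiple (suc m) n o → WithDetour a (Multiple m n) o
  multiple-a-suc (of-a {zero}  _)         = avoid (of-a z≤n)
  multiple-a-suc (of-a {suc i} (s≤s i≤m)) = subst (WithDetour a _) (sym (ℤ.suc-* (+ i) a)) (take (of-a i≤m))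
  multiple-a-suc (of-b j≤n)               = avoid (of-b j≤n)

  multiple-b-suc : ∀ {o} → Multiple m (suc n) o → WithDetour b (Multiple m n) o
  multiple-b-suc (of-b {zero}  _)         = avoid (of-b z≤n)
  multiple-b-suc (of-b {suc j} (s≤s j≤n)) = subst (WithDetour b _) (sym (ℤ.suc-* (+ j) b)) (take (of-b j≤n))
  multiple-b-suc (of-a i≤m)               = avoid (of-a i≤m)

  -- Each round finds one more detour inside the current set; `m` and `n` count the detours that
  -- change the weight by `a` and by `b`.
  flexible-subset : ∀ t {k} → ¬ Colourable (flexibilityBound p t k) Y →
                    ∃[ X ] X ⊆ˢ Y × ¬ Colourable (4 ℕ.+ k) X ×
                      ∃₂ λ m n → m ℕ.+ n ≡ t × Flexible Y X (Multiple m n)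
  flexible-subset zero ¬col =
    case linked-subset ¬col of λ { (X , X⊆Y , ¬colX , link) →
    X , X⊆Y , ¬colX , 0 , 0 , refl , λ u v u∈ v∈ u≢v →
    case link u∈ v∈ u≢v of λ { (w , isPath , through) →
    -- With no detours the only offset is 0, and the shift is the weight of the link itself.
    weight w , λ where
      _ (of-a z≤n) → w , isPath , through , ≈-reflexive (sym (ℤ.+-identityʳ (weight w)))
      _ (of-b z≤n) → w , isPath , through , ≈-reflexive (sym (ℤ.+-identityʳ (weight w))) }}
  flexible-subset {Y} (suc t) {k} ¬col =
    case flexible-subset t ¬col of λ { (X , X⊆Y , ¬colX , m , n , refl , flexible) →
    case detour {k} (λ col → ¬colX (colourable-≤ (ℕ.m≤n+m _ 4) col)) of λ where
      (X′ , X′⊆X , ¬colX′ , x , x∈ , inj₁ detours) →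
        X′ , X⊆Y ∘ X′⊆X , ¬colX′ , suc m , n , refl ,
        flexible-⊆ {Y = Y} {X′} multiple-a-suc (with-detour {Y = Y} {X} {X′} X⊆Y X′⊆X x∈ detours flexible)
      (X′ , X′⊆X , ¬colX′ , x , x∈ , inj₂ detours) →
        X′ , X⊆Y ∘ X′⊆X , ¬colX′ , m , suc n , ℕ.+-suc m n ,
        flexible-⊆ {Y = Y} {X′} multiple-b-suc (with-detour {Y = Y} {X} {X′} X⊆Y X′⊆X x∈ detours flexible) }

  -- The shift `c` depends on the ends, so for each pair of ends the offset aimed at is `r - c`,
  -- reached as a multiple of a unit.
  residue-linked-subset :
    gcd a (+ suc p) ≡ 1ℤ → gcd b (+ suc p) ≡ 1ℤ → ∀ r {k} → ¬ Colourable (linkBound p k) Y →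
    ∃[ X ] X ⊆ˢ Y × ¬ Colourable (4 ℕ.+ k) X ×
      (∀ u v → u ∈ˢ X → v ∈ˢ X → u ≢ v →
         Σ[ w ∈ Walk D u v ] IsPath w × Through (Y ∖ X) w × weight w ≈ r)
  residue-linked-subset {Y} gcd-a gcd-b r ¬col =
    case flexible-subset (suc p ℕ.+ suc p) ¬col of λ { (X , X⊆Y , ¬colX , m , n , m+n≡ , flexible) →
    X , X⊆Y , ¬colX , λ u v u∈ v∈ u≢v → case flexible u v u∈ v∈ u≢v of λ { (c , reach) →
    case offset m n m+n≡ c of λ { (o , multiple , o≈) →
    case reach o multiple of λ { (w , isPath , through , w≈) →
    w , isPath , through ,
    ≈-trans w≈ (≈-trans (+-cong {c} ≈-refl o≈) (≈-reflexive (restore c r))) }}}}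
    where
    restore : ∀ c r → c + (r - c) ≡ r
    restore = solve-∀
    offset : ∀ m n → m ℕ.+ n ≡ suc p ℕ.+ suc p → ∀ c → ∃[ o ] Multiple m n o × o ≈ r - c
    -- Since `m + n` is twice the modulus, `m` or `n` is at least the modulus, and the multiplier is
    -- in range.
    offset m n m+n≡ c with ℕ.≤-total (suc p) m
    ... | inj₁ q≤m = let i , i<q , eq = multiple-congruent (suc p) a (r - c) gcd-a in
                     _ , of-a (ℕ.≤-trans (ℕ.<⇒≤ i<q) q≤m) , eq
    ... | inj₂ m≤q = let j , j<q , eq = multiple-congruent (suc p) b (r - c) gcd-b in
                     _ , of-b (ℕ.≤-trans (ℕ.<⇒≤ j<q) q≤n) , eq
      where
      q≤n : suc p ℕ.≤ n
      q≤n = ℕ.+-cancelˡ-≤ (suc p) _ _ (ℕ.≤-trans (ℕ.≤-reflexive (sym m+n≡)) (ℕ.+-monoˡ-≤ n m≤q))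

-- Interiors of paths, and models of F inside a vertex set.

module _ {D : Digraph} where

  private
    variable
      u v y : V D

  tails⊆vertices : (w : Walk D u v) → y ∈ tails w → y ∈ vertices w
  tails⊆vertices w = ∈.∈-++⁺ˡ

  end∉tails : (w : Walk D u v) → IsPath w → v ∉ tails w
  end∉tails (e ◅ w) (u∉ ∷ _)      (here refl) = All.lookup u∉ (end∈ w) refl
  end∉tails (e ◅ w) (_ ∷ isPath) (there i)    = end∉tails w isPath i

  interior-∈ : (w : Walk D u v) → IsPath w → y ∈ interior w → y ∈ vertices w × y ≢ u × y ≢ v
  interior-∈ (e ◅ w) isPath@(u∉ ∷ _) i =
    there (tails⊆vertices w i) ,
    (λ { refl → All.lookup u∉ (tails⊆vertices w i) refl }) ,
    (λ { refl → end∉tails (e ◅ w) isPath (there i) })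

  vertices-cases : (w : Walk D u v) → y ∈ vertices w → y ≡ u ⊎ y ≡ v ⊎ y ∈ interior w
  vertices-cases ε       (here eq) = inj₁ eq
  vertices-cases (e ◅ w) (here eq) = inj₁ eq
  vertices-cases (e ◅ w) (there i) with ∈.∈-++⁻ (tails w) i
  ... | inj₁ i         = inj₂ (inj₂ i)
  ... | inj₂ (here eq) = inj₂ (inj₁ eq)

module _ (F : Digraph) where
  open Digraph F using (adjacent; order)

  arcsBetween : V F → V F → List (A F)
  arcsBetween u v with T? (adjacent u v)
  ... | yes e = (u , v , arc e) ∷ []
  ... | no  _ = []

  allArcs : List (A F)
  allArcs = concatMap (λ u → concatMap (arcsBetween u) (allFin order)) (allFin order)

  ∈-allArcs : ∀ e → e ∈ allArcs
  ∈-allArcs (u , v , arc e) =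
    ∈.∈-concatMap⁺ _ (Any.map (λ { refl →
      ∈.∈-concatMap⁺ _ (Any.map (λ { refl → between }) (∈.∈-allFin v)) }) (∈.∈-allFin u))
    where
    between : (u , v , arc e) ∈ arcsBetween u v
    between with T? (adjacent u v)
    ... | yes e′ = here (cong (λ e → u , v , e) (arc-irrelevant (arc e) (arc e′)))
    ... | no ¬e  = contradiction e ¬e

-- A partial subdivision: only the arcs in `es` have routes, and everything lies in `X`, so that
-- later routes can run outside `X`.
record Model (F : Digraph) (es : List (A F)) {D : Digraph} (X : VertexSet D)
             (Admissible : A F → ∀ {x y} → Walk D x y → Set) : Set where
  field
    branch           : V F → V D
    branch-injective : Injective _≡_ _≡_ branch
    branch∈          : ∀ v → branch v ∈ˢ X
    route            : ∀ {e} → e ∈ es → Walk D (branch (proj₁ e)) (branch (proj₁ (proj₂ e)))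
    isPath           : ∀ {e} (i : e ∈ es) → IsPath (route i)
    route⊆           : ∀ {e} (i : e ∈ es) {y} → y ∈ vertices (route i) → y ∈ˢ X
    interior-new     : ∀ {e} (i : e ∈ es) v → branch v ∉ interior (route i)
    disjoint         : ∀ {e e′} → e ≢ e′ → (i : e ∈ es) (j : e′ ∈ es) →
                       Disjoint (interior (route i)) (interior (route j))
    admissible       : ∀ {e} (i : e ∈ es) → Admissible e (route i)

module _ {F D : Digraph} {Admissible : A F → ∀ {x y} → Walk D x y → Set} {X Y : VertexSet D} where

  -- The interior of the new route avoids `X`, which contains all branch vertices and all older
  -- routes.
  add-path : ∀ {e es} → X ⊆ˢ Y →
             (∀ u v → u ∈ˢ X → v ∈ˢ X → u ≢ v →
                Σ[ w ∈ Walk D u v ] IsPath w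
                  × (∀ {y} → y ∈ vertices w → y ≡ u ⊎ y ≡ v ⊎ y ∈ˢ Y ∖ X)
                  × Admissible e w) →
             Model F es X Admissible → Model F (e ∷ es) Y Admissible
  add-path {e@(s , t , s⟶t)} {es} X⊆Y link M
    with link (Model.branch M s) (Model.branch M t) (Model.branch∈ M s) (Model.branch∈ M t)
              (λ eq → distinct s⟶t (Model.branch-injective M eq))
    where
    distinct : ∀ {s t} → F ∋ s ⟶ t → s ≢ t
    distinct (arc e) refl = Digraph.loopless F _ e
  ... | w , w-isPath , through , w-admissible = record
    { branch           = branch
    ; branch-injective = branch-injective
    ; branch∈          = X⊆Y ∘ branch∈
    ; route            = route′
    ; isPath           = λ { (here refl) → w-isPath ; (there i) → isPath i }
    ; route⊆           = λ { (here refl) → w⊆ ; (there i) → X⊆Y ∘ route⊆ i }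
    ; interior-new     = λ { (here refl) v i → w-interior i (branch∈ v)
                           ; (there i) v     → interior-new i v }
    ; disjoint         = disjoint′
    ; admissible       = λ { (here refl) → w-admissible ; (there i) → admissible i }
    }
    where
    open Model M
    route′ : ∀ {e′} → e′ ∈ e ∷ es → Walk D (branch (proj₁ e′)) (branch (proj₁ (proj₂ e′)))
    route′ (here refl) = w
    route′ (there i)   = route i
    w⊆ : ∀ {y} → y ∈ vertices w → y ∈ˢ Y
    w⊆ i with through i
    ... | inj₁ refl                = X⊆Y (branch∈ s)
    ... | inj₂ (inj₁ refl)         = X⊆Y (branch∈ t)
    ... | inj₂ (inj₂ (y∈Y , _))    = y∈Y
    w-interior : ∀ {y} → y ∈ interior w → ¬ y ∈ˢ X
    w-interior i with interior-∈ w w-isPath i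
    ... | i , ≢s , ≢t with through i
    ...   | inj₁ eq                = contradiction eq ≢s
    ...   | inj₂ (inj₁ eq)         = contradiction eq ≢t
    ...   | inj₂ (inj₂ (_ , y∉X)) = y∉X
    old-interior : ∀ {e′} (i : e′ ∈ es) {y} → y ∈ interior (route i) → y ∈ˢ X
    old-interior i j = route⊆ i (proj₁ (interior-∈ (route i) (isPath i) j))
    disjoint′ : ∀ {e₁ e₂} → e₁ ≢ e₂ → (i : e₁ ∈ e ∷ es) (j : e₂ ∈ e ∷ es) →
                Disjoint (interior (route′ i)) (interior (route′ j))
    disjoint′ e₁≢e₂ (here refl) (here refl) = contradiction refl e₁≢e₂
    disjoint′ e₁≢e₂ (here refl) (there j)   = λ (k , l) → w-interior k (old-interior j l)
    disjoint′ e₁≢e₂ (there i)   (here refl) = λ (k , l) → w-interior l (old-interior i k)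
    disjoint′ e₁≢e₂ (there i)   (there j)   = disjoint e₁≢e₂ i j

-- Branch vertices and the induction on the arcs of F.

branchBound : ℕ → ℕ
branchBound zero    = 1
branchBound (suc n) = 2 ℕ.* suc (branchBound n)

module _ (D : Digraph) (Z₁ Z₂ : ArcSet D) where
  open Colourings D Z₁ Z₂

  -- Removing each chosen vertex halves the bound; the successor in `branchBound` gives it the shape
  -- that `difference-bound` expects.
  distinct-vertices : ∀ n {X} → ¬ Colourable (branchBound n) X →
                      Σ[ f ∈ (Fin n → V D) ] Injective _≡_ _≡_ f × (∀ i → f i ∈ˢ X)
  distinct-vertices zero    ¬col = (λ ()) , (λ { {()} }) , λ ()
  distinct-vertices (suc n) {X} ¬col =
    case inhabited ¬col of λ { (x , x∈) →
    case distinct-vertices n {X ∖ ⁅ x ⁆}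
           (difference-bound ⁅ x ⁆ ¬col (singleton-colourable x) ∘ colourable-≤ (ℕ.n≤1+n _))
    of λ { (f , f-injective , f∈) → extend x f , extend-injective x f f-injective (proj₂ ∘ f∈) , λ where
      zero    → x∈
      (suc i) → proj₁ (f∈ i) }}
    where
    extend : ∀ {n} → V D → (Fin n → V D) → Fin (suc n) → V D
    extend x f zero    = x
    extend x f (suc i) = f i
    extend-injective : ∀ {n} x (f : Fin n → V D) → Injective _≡_ _≡_ f → (∀ i → f i ≢ x) →
                       Injective _≡_ _≡_ (extend x f)
    extend-injective x f inj ≢x {zero}  {zero}  _  = refl
    extend-injective x f inj ≢x {zero}  {suc j} eq = contradiction (sym eq) (≢x j)
    extend-injective x f inj ≢x {suc i} {zero}  eq = contradiction eq (≢x i)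
    extend-injective x f inj ≢x {suc i} {suc j} eq = cong suc (inj eq)

module Models (F : Digraph) (a b r q : A F → ℤ)
  (units : ∀ e → + 2 ℤ.≤ q e × gcd (a e) (q e) ≡ 1ℤ × gcd (b e) (q e) ≡ 1ℤ) where
  open import Data.Integer using (_+_; _*_)

  p : A F → ℕ
  p e = ℕ.pred ℤ.∣ q e ∣

  modulus : ∀ e → q e ≡ + suc (p e)
  modulus e = positive (proj₁ (units e))
    where
    positive : ∀ {q} → + 2 ℤ.≤ q → q ≡ + suc (ℕ.pred ℤ.∣ q ∣)
    positive (ℤ.+≤+ (s≤s _)) = refl

  modelBound : List (A F) → ℕ
  modelBound []       = branchBound (Digraph.order F)
  modelBound (e ∷ es) = linkBound (p e) (modelBound es)

  module _ (D : Digraph) (Z₁ Z₂ : ArcSet D) where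
    open Colourings D Z₁ Z₂

    Congruent : A F → ∀ {x y} → Walk D x y → Set
    Congruent e w = (a e * + ∣ w ∩ Z₁ ∣ + b e * + ∣ w ∩ Z₂ ∣) ≡ r e [mod q e ]

    -- The remaining arcs are modelled inside a linked subset, whose complement in the current set
    -- is reserved for the route of `e`.
    model : ∀ es {X} → ¬ Colourable (modelBound es) X → Model F es X Congruent
    model []       ¬col =
      case distinct-vertices D Z₁ Z₂ _ ¬col of λ { (branch , branch-injective , branch∈) → record
      { branch           = branch
      ; branch-injective = branch-injective
      ; branch∈          = branch∈
      ; route            = λ ()
      ; isPath           = λ ()
      ; route⊆            = λ ()
      ; interior-new     = λ ()
      ; disjoint         = λ _ ()
      ; admissible       = λ ()
      } }
    model (e ∷ es) {Y} ¬col =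
      case residue-linked-subset {Y} (unit (a e) (proj₁ (proj₂ (units e)))) (unit (b e) (proj₂ (proj₂ (units e)))) (r e) ¬col
      of λ { (X , X⊆Y , ¬colX , link) →
      add-path {Admissible = Congruent} {X} {Y} X⊆Y
        (λ u v u∈ v∈ u≢v → case link u v u∈ v∈ u≢v of λ { (w , isPath , through , w≈) →
           w , isPath , through ,
           subst (λ m → weight w ≡ r e [mod m ]) (sym (modulus e)) (difference-divisible w≈) })
        (model es (¬colX ∘ colourable-≤ (ℕ.m≤n+m _ 4))) }
      where
      open LinksOfAnyResidue D Z₁ Z₂ (a e) (b e) (p e)
      open Weights D Z₁ Z₂ (a e) (b e) (p e)
      open Congruence (+ suc (p e))
      unit : ∀ x → gcd x (q e) ≡ 1ℤ → gcd x (+ suc (p e)) ≡ 1ℤ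
      unit x = subst (λ m → gcd x m ≡ 1ℤ) (modulus e)

-- Realising a complete model as a subdivision.

module Realisation {F D : Digraph} {es : List (A F)} {X : VertexSet D}
  {Admissible : A F → ∀ {x y} → Walk D x y → Set}
  (M : Model F es X Admissible) (complete : ∀ e → e ∈ es) where
  open Model M
  open import Data.List.Membership.DecPropositional (Fin._≟_ {Digraph.order D}) using (_∈?_)

  branchPath : ∀ e → Walk D (branch (proj₁ e)) (branch (proj₁ (proj₂ e)))
  branchPath e = route (complete e)

  anyArc? : {P : A F → Set} → Decidable P → Dec (∃ P)
  anyArc? P? = map′ (λ i → Any.satisfied i) (λ (e , p) → Any.map (λ { refl → p }) (complete e)) (Any.any? P? es)

  Used : V D → Set
  Used x = (∃[ v ] branch v ≡ x) ⊎ (∃[ e ] x ∈ vertices (branchPath e))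

  used? : Decidable Used
  used? x = Fin.any? (λ v → branch v Fin.≟ x) ⊎-dec anyArc? (λ e → x ∈? vertices (branchPath e))

  HasEnds : V D → V D → A D → Set
  HasEnds x y a = proj₁ a ≡ x × proj₁ (proj₂ a) ≡ y

  UsedArc : V D → V D → Set
  UsedArc x y = ∃[ e ] Any (HasEnds x y) (arcs (branchPath e))

  usedArc-isArc : ∀ {x y} → UsedArc x y → D ∋ x ⟶ y
  usedArc-isArc (_ , i) with Any.satisfied i
  ... | (_ , _ , e) , refl , refl = e

  usedVertices : List (V D)
  usedVertices = filter used? (allFin (Digraph.order D))

  -- What follows relies only on the types of these components, not on how the used vertices are
  -- enumerated.
  abstract
    size : ℕ
    size = length usedVertices

    vertex : Fin size → V D
    vertex = lookup usedVertices

    vertex-injective : Injective _≡_ _≡_ vertex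
    vertex-injective = lookup-injective (Unique.filter⁺ used? (Unique.allFin⁺ _))

    vertex-used : ∀ i → Used (vertex i)
    vertex-used i = proj₂ (∈.∈-filter⁻ used? {xs = allFin _} (∈.∈-lookup {xs = usedVertices} i))

    index : ∀ {x} → Used x → ∃[ i ] vertex i ≡ x
    index {x} used = Any.index x∈ , sym (Any.lookup-index x∈)
      where
      x∈ : x ∈ usedVertices
      x∈ = ∈.∈-filter⁺ used? (∈.∈-allFin x) used

    usedArc? : ∀ x y → Dec (UsedArc x y)
    usedArc? x y = anyArc? λ e → Any.any? (λ a → proj₁ a Fin.≟ x ×-dec proj₁ (proj₂ a) Fin.≟ y) (arcs (branchPath e))

  -- Only arcs on routes are kept: the induced subdigraph could have arcs outside every branching
  -- path.
  H : Digraph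
  H = record
    { order    = size
    ; adjacent = λ i j → ⌊ usedArc? (vertex i) (vertex j) ⌋
    ; loopless = λ i e → Digraph.loopless D _ (_∋_⟶_.isArc (usedArc-isArc (toWitness e)))
    }

  ι : H ↪ D
  ι = record
    { vertex    = vertex
    ; injective = vertex-injective
    ; preserves = λ (arc e) → usedArc-isArc (toWitness e)
    }

  open _↪_ ι using (onArc)

  -- The ends are indices constrained by equations, so the recursion can continue from the index
  -- found for the next vertex. Equality of arc lists transfers tails, interiors and counts at once.
  lift : ∀ {x y} (w : Walk D x y) →
         (∀ {a} → a ∈ arcs w → UsedArc (proj₁ a) (proj₁ (proj₂ a)) × Used (proj₁ (proj₂ a))) →
         ∀ i j → vertex i ≡ x → vertex j ≡ y → Σ[ w′ ∈ Walk H i j ] map onArc (arcs w′) ≡ arcs w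
  lift ε       used i j refl eq with vertex-injective eq
  ... | refl = ε , refl
  lift (e ◅ w) used i j refl refl with index (proj₂ (used (here refl)))
  ... | k , refl =
    let w′ , eq = lift w (used ∘ there) k j refl refl in
    arc (fromWitness (proj₁ (used (here refl)))) ◅ w′ ,
    cong₂ _∷_ (cong (λ f → vertex i , vertex k , f) (arc-irrelevant _ e)) eq

  heads⊆vertices : ∀ {u v} (w : Walk D u v) {a : A D} → a ∈ arcs w → proj₁ (proj₂ a) ∈ vertices w
  heads⊆vertices (e ◅ w) (here refl) = there (start∈ w)
  heads⊆vertices (e ◅ w) (there i)   = there (heads⊆vertices w i)

  branchᴴ : V F → V H
  branchᴴ v = proj₁ (index (inj₁ (v , refl)))

  vertex-branchᴴ : ∀ v → vertex (branchᴴ v) ≡ branch v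
  vertex-branchᴴ v = proj₂ (index (inj₁ (v , refl)))

  lifted : ∀ e → Σ[ w ∈ Walk H (branchᴴ (proj₁ e)) (branchᴴ (proj₁ (proj₂ e))) ]
                   map onArc (arcs w) ≡ arcs (branchPath e)
  lifted e = lift (branchPath e)
    (λ i → (e , Any.map (λ { refl → refl , refl }) i) , inj₂ (e , heads⊆vertices (branchPath e) i))
    _ _ (vertex-branchᴴ _) (vertex-branchᴴ _)

  pathᴴ : ∀ e → Walk H (branchᴴ (proj₁ e)) (branchᴴ (proj₁ (proj₂ e)))
  pathᴴ e = proj₁ (lifted e)

  tails-lifted : ∀ e → map vertex (tails (pathᴴ e)) ≡ tails (branchPath e)
  tails-lifted e = begin
    map vertex (map proj₁ (arcs (pathᴴ e)))   ≡⟨ List.map-∘ (arcs (pathᴴ e)) ⟨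
    map (proj₁ ∘ onArc) (arcs (pathᴴ e))      ≡⟨ List.map-∘ (arcs (pathᴴ e)) ⟩
    map proj₁ (map onArc (arcs (pathᴴ e)))    ≡⟨ cong (map proj₁) (proj₂ (lifted e)) ⟩
    tails (branchPath e)                      ∎
    where open ≡-Reasoning

  interior-lifted : ∀ e → map vertex (interior (pathᴴ e)) ≡ interior (branchPath e)
  interior-lifted e = trans (sym (List.drop-map 1 (tails (pathᴴ e)))) (cong (drop 1) (tails-lifted e))

  vertices-lifted : ∀ e → map vertex (vertices (pathᴴ e)) ≡ vertices (branchPath e)
  vertices-lifted e = trans (List.map-++ vertex (tails (pathᴴ e)) _)
                            (cong₂ _∷ʳ_ (tails-lifted e) (vertex-branchᴴ _))

  ∈-interior-lifted : ∀ e {i x} → vertex i ≡ x → i ∈ interior (pathᴴ e) → x ∈ interior (branchPath e)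
  ∈-interior-lifted e refl i∈ = subst (_ ∈_) (interior-lifted e) (∈.∈-map⁺ vertex i∈)

  subdivision : Subdivision F H
  subdivision = record
    { branch            = branchᴴ
    ; branch-injective  = λ {u} {v} eq →
        branch-injective (trans (sym (vertex-branchᴴ u)) (trans (cong vertex eq) (vertex-branchᴴ v)))
    ; path              = pathᴴ
    ; isPath            = λ e → Unique.map⁻ (subst Unique (sym (vertices-lifted e)) (isPath (complete e)))
    ; interior-new      = λ e v i → interior-new (complete e) v (∈-interior-lifted e (vertex-branchᴴ v) i)
    ; interior-disjoint = λ {e} {e′} e≢e′ (i , j) →
        disjoint e≢e′ (complete e) (complete e′) (∈-interior-lifted e refl i , ∈-interior-lifted e′ refl j)
    ; covers-vertices   = covers-vertices
    ; covers-arcs       = covers-arcs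
    }
    where
    covers-vertices : ∀ x → (∃[ v ] branchᴴ v ≡ x) ⊎ (∃[ e ] x ∈ interior (pathᴴ e))
    covers-vertices x with vertex-used x
    ... | inj₁ (v , eq) = inj₁ (v , vertex-injective (trans (vertex-branchᴴ v) eq))
    ... | inj₂ (e , i)  with ∈.∈-map⁻ vertex (subst (vertex x ∈_) (sym (vertices-lifted e)) i)
    ...   | y , y∈ , eq with vertex-injective eq
    ...     | refl with vertices-cases (pathᴴ e) y∈
    ...       | inj₁ eq        = inj₁ (_ , sym eq)
    ...       | inj₂ (inj₁ eq) = inj₁ (_ , sym eq)
    ...       | inj₂ (inj₂ i)  = inj₂ (e , i)

    covers-arcs : ∀ a → ∃[ e ] a ∈ arcs (pathᴴ e)
    covers-arcs (i , j , arc t) with toWitness t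
    ... | e , any = e , Any.map same-arc (Any.map⁻ (subst (Any _) (sym (proj₂ (lifted e))) any))
      where
      same-arc : ∀ {a} → HasEnds (vertex i) (vertex j) (onArc a) → (i , j , arc t) ≡ a
      same-arc (eq , eq′) with vertex-injective eq | vertex-injective eq′
      ... | refl | refl = cong (λ f → i , j , f) (arc-irrelevant _ _)

  count-pullback : ∀ Z e → ∣ pathᴴ e ∩ pullback ι Z ∣ ≡ ∣ branchPath e ∩ Z ∣
  count-pullback Z e = trans (count-map (arcs (pathᴴ e))) (cong (length ∘ filterᵇ Z) (proj₂ (lifted e)))
    where
    count-map : ∀ as → length (filterᵇ (Z ∘ onArc) as) ≡ length (filterᵇ Z (map onArc as))
    count-map []       = refl
    count-map (a ∷ as) with Z (onArc a)
    ... | true  = cong suc (count-map as)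
    ... | false = count-map as

-- From the unbalanced dichromatic number to colourings.

module _ (D : Digraph) (Z₁ Z₂ : ArcSet D) where
  open Colourings D Z₁ Z₂

  surjective-or-misses : ∀ {k} (f : V D → Fin k) → (∀ i → ∃[ v ] f v ≡ i) ⊎ (∃[ i ] (∀ v → i ≢ f v))
  surjective-or-misses f with Fin.any? (λ i → ¬? (Fin.any? λ v → f v Fin.≟ i))
  ... | yes (i , missed) = inj₂ (i , λ v eq → missed (v , sym eq))
  ... | no none          = inj₁ λ i → decidable-stable (Fin.any? λ v → f v Fin.≟ i) λ missed → none (i , missed)

  -- Parts must be nonempty while colours may be missing, so missed colours are removed one at a
  -- time until the colouring is surjective.
  μ≤colours : ∀ {k} → Colourable k full → μ D Z₁ Z₂ ℕ.≤ k
  μ≤colours {zero}  (f , good) = proj₂ (μ-isLeast D Z₁ Z₂) 0 (f , (λ ()) , λ ())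
  μ≤colours {suc k} (f , good) with surjective-or-misses f
  ... | inj₁ surjective = proj₂ (μ-isLeast D Z₁ Z₂) (suc k)
          (f , surjective , λ i (C , inside , unb) → good i (C , All.map (tt ,_) inside , unb))
  ... | inj₂ (i , missed) = ℕ.m≤n⇒m≤1+n (μ≤colours ((λ v → punchOut (missed v)) , good′))
    where
    good′ : IsColouring full (λ v → punchOut (missed v))
    good′ j (C , inside , unb) = good (f (Cycle.base C)) (C , All.map same inside , unb)
      where
      same : ∀ {v} → v ∈ˢ full {D} × punchOut (missed v) ≡ j → v ∈ˢ full {D} × f v ≡ f (Cycle.base C)
      same {v} (_ , eq) = tt , Fin.punchOut-injective (missed v) (missed _) (trans eq (sym (proj₂ (All-base C inside))))

open import Data.Integer using (_+_; _*_; _≤_)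
open import Data.Nat using (_≥_)

theorem1p2 : (F : Digraph) (a b r q : A F → ℤ) →
    (∀ e → + 2 ≤ q e × gcd (a e) (q e) ≡ 1ℤ × gcd (b e) (q e) ≡ 1ℤ) →
    Σ[ N ∈ ℕ ] ((D : Digraph) (Z₁ Z₂ : ArcSet D) → μ D Z₁ Z₂ ≥ N →
    Σ[ H ∈ Digraph ] Σ[ S ∈ Subdivision F H ] Σ[ ι ∈ H ↪ D ]
    (∀ e → (a e * + ∣ path S e ∩ pullback ι Z₁ ∣ + b e * + ∣ path S e ∩ pullback ι Z₂ ∣)
    ≡ r e [mod q e ]))
theorem1p2 F a b r q units = suc (modelBound (allArcs F)) , λ D Z₁ Z₂ μ≥N →
  -- `N` exceeds `modelBound` by one, so no colouring of all of `D` has only `modelBound` colours.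
  let M = model D Z₁ Z₂ (allArcs F) {full} (λ col → ℕ.<⇒≱ μ≥N (μ≤colours D Z₁ Z₂ col))
      open Realisation M (∈-allArcs F)
  in H , subdivision , ι , λ e →
     subst₂ (λ k l → (a e * + k + b e * + l) ≡ r e [mod q e ])
       (sym (count-pullback Z₁ e)) (sym (count-pullback Z₂ e))
       (Model.admissible M (∈-allArcs F e))
  where open Models F a b r q units
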